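{- The refinement $P_{KM}=(\mathsf O_{KM},\mathsf R_{KM},\mathsf{TTP}_{KM})$ corresponding to the Kremer–Markowitch (KM) non-repudiation protocol is in $P_{AGS}$, and the refinements $P_{ASW}$ and $P_{GJM}$ corresponding to the Asokan–Shoup–Waidner (ASW) certified mail protocol and to the Garay–Jakobsson–MacKenzie (GJM) protocol are not in $P_{AGS}$.
   Context: **Protocol model.** There are three (most general) processes: the originator $\mathsf O$, the recipient $\mathsf R$ and the trusted third party $\mathsf{TTP}$. Messages: $\mathsf O$ may send $m_1,m_3$ to $\mathsf R$ and $a_1^{\mathsf O}$ (abort request), $r_1^{\mathsf O}$ (resolve request) to $\mathsf{TTP}$; $\mathsf R$ may send $m_2,m_4$ to $\mathsf O$ and $r_1^{\mathsf R}$ (resolve request) to $\mathsf{TTP}$; $\mathsf{TTP}$ may send $a_2^{\mathsf O}$ (abort token) or $r_2^{\mathsf O}$ (replacement for $\mathsf R$'s signature) to $\mathsf O$, and $a_2^{\mathsf R}$ (abort token) or $r_2^{\mathsf R}$ (replacement for $\mathsf O$'s signature) to $\mathsf R$. Each process, when scheduled, chooses a move: the idle move $\iota$ or sending a message it is able to compose; the $\mathsf{TTP}$ also has the moves $[a_2^{\mathsf O},a_2^{\mathsf R}]$ and $[r_2^{\mathsf O},r_2^{\mathsf R}]$, each sending both listed messages (in some order). Composability: $\mathsf R$ can send $m_2$ only after receiving $m_1$; $\mathsf O$ can send $m_3$ only after receiving $m_2$; $\mathsf R$ can send $m_4$ only after receiving $m_3$; $\mathsf O$ can send $r_1^{\mathsf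 O}$ only after receiving $m_2$; $\mathsf R$ can send $r_1^{\mathsf R}$ only after receiving $m_1$; $\mathsf O$ can send $m_1$ and $a_1^{\mathsf O}$ from the start. The most general processes may choose any composable move at any state. The $\mathsf{TTP}$ is *reasonable*: it never sends a message unless it has received an abort or resolve request; it processes messages first-in-first-out; if the first request received is an abort request it eventually sends an abort token; if the first request received is a resolve request it eventually sends an agent signature. **Predicates** (Boolean variables, initially false, monotonic: once true they stay true). Set by $\mathsf O$: $M_1$, $M_3$, $\mathrm{ABR}^{\mathsf O}$, $\mathrm{RES}^{\mathsf O}$ on sending $m_1,m_3,a_1^{\mathsf O},r_1^{\mathsf O}$; $\mathrm{EOR}$ on receiving $m_2$ or $r_2^{\mathsf O}$; $\mathrm{Sig}_{\mathsf R}^{\mathsf R}$ on receiving $m_4$; $\mathrm{Sig}_{\mathsf R}^{\mathsf{TTP}}$ on receiving $r_2^{\mathsf O}$; $\mathrm{AB}_{\mathsf O}$ on receiving $a_2^{\mathsf O}$. Set by $\mathsf R$: $M_2,M_4,\mathrm{RES}^{\mathsf R}$ on sending $m_2,m_4,r_1^{\mathsf R}$; $\mathrm{EOO}$ on receiving $m_1$ or $r_2^{\mathsf R}$; $\mathrm{Sig}_{\mathsf O}^{\mathsf O}$ on receiving $m_3$; $\mathrm{Sig}_{\mathsf O}^{\mathsf{TTP}}$ on receiving $r_2^{\mathsf R}$; $\mathrm{AB}_{\mathsf R}$ on receiving $a_2^{\mathsf R}$. Set by $\mathsf{TTP}$: $\mathrm{ABR}$ on receiving $a_1^{\mathsf O}$;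 $\mathrm{RES}$ on receiving $r_1^{\mathsf O}$ or $r_1^{\mathsf R}$; $A_2^{\mathsf O},A_2^{\mathsf R},R_2^{\mathsf O},R_2^{\mathsf R}$ on sending $a_2^{\mathsf O},a_2^{\mathsf R},r_2^{\mathsf O},r_2^{\mathsf R}$. A state is a valuation of all these variables; each process sees only the variables it sets. **Refinement.** $P'\preceq P$ means that $P'$ has the same variables as $P$, and at every valuation of those variables a nonempty subset of the moves of $P$, with the same effect. **Traces.** Channels between $\mathsf O$ and $\mathsf R$ are unreliable (messages may never be delivered); channels between each agent and the $\mathsf{TTP}$ are resilient (every message is eventually delivered, without a fixed bound and possibly out of order). A scheduler assigns turns as a function of the history; it is fair if every process gets infinitely many turns. $[\![P_1\parallel P_2\parallel P_3\parallel\mathrm{Sc}]\!]$ is the set of infinite sequences of valuations, starting from the all-false valuation, generated by the processes under all fair schedulers and all allowed channel behaviours. A formula is identified with the set of traces satisfying it. **Objectives** (LTL; $\Box$ = always, $\Diamond$ = eventually): - $\varphi_{\mathsf O}=\Diamond M_1\wedge\Box\big[(\Diamond\mathrm{Sig}_{\mathsf R}^{\mathsf R}\vee(\Diamond\mathrm{Sig}_{\mathsf R}^{\mathsf{TTP}}\wedge\Box\neg\mathrm{AB}_{\mathsf O}))\vee(\Diamond\mathrm{AB}_{\mathsf O}\wedge\Box(\neg\mathrm{Sig}_{\mathsf O}^{\mathsf O}\wedge\neg\mathrm{Sig}_{\mathsf O}^{\mathsf{TTP}}))\big]$. - $\varphi_{\mathsf R}=\Box\big[\mathrm{EOO}\Rightarrow\big((\Diamond\mathrm{Sig}_{\mathsf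 O}^{\mathsf O}\vee(\Diamond\mathrm{Sig}_{\mathsf O}^{\mathsf{TTP}}\wedge\Box\neg\mathrm{AB}_{\mathsf R}))\vee(\Diamond\mathrm{AB}_{\mathsf R}\wedge\Box(\neg\mathrm{Sig}_{\mathsf R}^{\mathsf R}\wedge\neg\mathrm{Sig}_{\mathsf R}^{\mathsf{TTP}}))\big)\big]$. - $\varphi_{\mathsf{TTP}}$ is the conjunction of: $\Box((\mathrm{ABR}\vee\mathrm{RES})\Rightarrow(\Diamond\mathrm{AB}_{\mathsf O}\vee\Diamond\mathrm{AB}_{\mathsf R}\vee\Diamond\mathrm{Sig}_{\mathsf O}^{\mathsf{TTP}}\vee\Diamond\mathrm{Sig}_{\mathsf R}^{\mathsf{TTP}}))$; $\Box(\mathrm{Sig}_{\mathsf O}^{\mathsf{TTP}}\Rightarrow(\Diamond\mathrm{Sig}_{\mathsf R}^{\mathsf{TTP}}\wedge\Box(\neg\mathrm{AB}_{\mathsf O}\wedge\neg\mathrm{AB}_{\mathsf R})))$; $\Box(\mathrm{Sig}_{\mathsf R}^{\mathsf{TTP}}\Rightarrow(\Diamond\mathrm{Sig}_{\mathsf O}^{\mathsf{TTP}}\wedge\Box(\neg\mathrm{AB}_{\mathsf O}\wedge\neg\mathrm{AB}_{\mathsf R})))$; $\Box(\mathrm{AB}_{\mathsf O}\Rightarrow(\Diamond\mathrm{AB}_{\mathsf R}\wedge\Box(\neg\mathrm{Sig}_{\mathsf O}^{\mathsf{TTP}}\wedge\neg\mathrm{Sig}_{\mathsf R}^{\mathsf{TTP}})))$;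 $\Box(\mathrm{AB}_{\mathsf R}\Rightarrow(\Diamond\mathrm{AB}_{\mathsf O}\wedge\Box(\neg\mathrm{Sig}_{\mathsf O}^{\mathsf{TTP}}\wedge\neg\mathrm{Sig}_{\mathsf R}^{\mathsf{TTP}})))$. **$P_{AGS}$** is the set of triples $(\mathsf O',\mathsf R',\mathsf{TTP}')$ with $\mathsf O'\preceq\mathsf O$, $\mathsf R'\preceq\mathsf R$, $\mathsf{TTP}'\preceq\mathsf{TTP}$ such that (for all fair schedulers and channel behaviours) (1) $[\![\mathsf O'\parallel\mathsf R\parallel\mathsf{TTP}\parallel\mathrm{Sc}]\!]\subseteq(\varphi_{\mathsf R}\wedge\varphi_{\mathsf{TTP}})\Rightarrow\varphi_{\mathsf O}$; (2) $[\![\mathsf O\parallel\mathsf R'\parallel\mathsf{TTP}\parallel\mathrm{Sc}]\!]\subseteq(\varphi_{\mathsf O}\wedge\varphi_{\mathsf{TTP}})\Rightarrow\varphi_{\mathsf R}$; (3) $[\![\mathsf O\parallel\mathsf R\parallel\mathsf{TTP}'\parallel\mathrm{Sc}]\!]\subseteq(\varphi_{\mathsf O}\wedge\varphi_{\mathsf R})\Rightarrow\varphi_{\mathsf{TTP}}$; (4) $[\![\mathsf O'\parallel\mathsf R'\parallel\mathsf{TTP}'\parallel\mathrm{Sc}]\!]\subseteq\varphi_{\mathsf O}\wedge\varphi_{\mathsf R}\wedge\varphi_{\mathsf{TTP}}$. **The three protocols.** All share the same agent rules (main protocol): $\mathsf O$ sends $m_1$; $\mathsf R$ answers with $m_2$;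 if $m_2$ does not arrive on time, $\mathsf O$ sends $a_1^{\mathsf O}$ to the $\mathsf{TTP}$; otherwise $\mathsf O$ sends $m_3$; if $m_3$ does not arrive on time, $\mathsf R$ sends $r_1^{\mathsf R}$ to the $\mathsf{TTP}$; otherwise $\mathsf R$ sends $m_4$; if $m_4$ does not arrive on time, $\mathsf O$ sends $r_1^{\mathsf O}$ to the $\mathsf{TTP}$. "On time" refers to waiting (idling) a finite bounded number of turns; $\mathsf O$ and the $\mathsf{TTP}$ idle only boundedly often before acting as prescribed. In particular $\mathsf O$ does not abort before sending $m_1$ or after sending $m_3$, and does not send $m_3$ after sending $a_1^{\mathsf O}$. The $\mathsf{TTP}$ keeps a persistent database and responds as follows ("aborted"/"recovered" refers to whether it has previously aborted/resolved the instance): - *KM*: on $a_1^{\mathsf O}$: if aborted or recovered then $\iota$, else $[a_2^{\mathsf O},a_2^{\mathsf R}]$; on $r_1^{\mathsf O}$ or $r_1^{\mathsf R}$: if aborted or recovered then $\iota$, else $[r_2^{\mathsf O},r_2^{\mathsf R}]$. - *ASW*: on $a_1^{\mathsf O}$: if $\mathsf R$ has recovered, invite $\mathsf O$ to recover (an additional move $req^{\mathsf O}$), else $a_2^{\mathsf O}$; on $r_1^{\mathsf O}$: if aborted then $a_2^{\mathsf O}$, else $r_2^{\mathsf O}$; on $r_1^{\mathsf R}$: if aborted then $a_2^{\mathsf R}$, else $r_2^{\mathsf R}$. - *GJM*: on $a_1^{\mathsf O}$: if recovered then $r_2^{\mathsf O}$, else $a_2^{\mathsf O}$; on $r_1^{\mathsf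 O}$: if aborted then $a_2^{\mathsf O}$, else $r_2^{\mathsf O}$; on $r_1^{\mathsf R}$: if aborted then $a_2^{\mathsf R}$, else $r_2^{\mathsf R}$. -}

module Defs where

open import Level using (0ℓ)
open import Data.Bool using (Bool; true; false; not; _∧_; _∨_; if_then_else_; T)
open import Data.Bool.ListAction using (any)
open import Data.Fin using (Fin; #_)
import Data.Fin.Properties as Fin
open import Data.List using (List; []; _∷_; _++_; [_]; concatMap; applyDownFrom; head)
open import Data.List.Membership.Propositional using (_∈_)
import Data.List.Membership.DecPropositional as DecMembership
open import Data.List.Relation.Unary.Unique.Propositional using (Unique)
open import Data.Maybe using (Maybe; just; nothing; is-just)
open import Data.Nat using (ℕ; suc; _+_; _≤_; _<_; _≤ᵇ_)
open import Data.Product using (_×_; _,_; ∃-syntax)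
open import Data.Sum using (_⊎_)
open import Data.Vec using (Vec; lookup) renaming ([] to []ᵛ; _∷_ to _∷ᵛ_)
open import Relation.Binary using (DecidableEquality)
open import Relation.Binary.PropositionalEquality using (_≡_; refl; sym; trans; cong)
open import Relation.Nullary using (does; yes; no)
open import Relation.Nullary.Decidable using (map′)
open import Relation.Unary using (Pred; _∩_; _∪_; _⇒_; ∁; _⊆_; Satisfiable)

data Agent : Set where
  O R TTP : Agent

infix 4 _≟ᵃ_ _≟ᵐ_

_≟ᵃ_ : DecidableEquality Agent
O   ≟ᵃ O   = yes refl
O   ≟ᵃ R   = no λ ()
O   ≟ᵃ TTP = no λ ()
R   ≟ᵃ O   = no λ ()
R   ≟ᵃ R   = yes refl
R   ≟ᵃ TTP = no λ ()
TTP ≟ᵃ O   = no λ ()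
TTP ≟ᵃ R   = no λ ()
TTP ≟ᵃ TTP = yes refl

-- reqᴼ is the invitation to recover that only the ASW protocol uses.
data Msg : Set where
  m₁ m₂ m₃ m₄ a₁ᴼ r₁ᴼ r₁ᴿ a₂ᴼ a₂ᴿ r₂ᴼ r₂ᴿ reqᴼ : Msg

sender : Msg → Agent
sender m₁   = O
sender m₂   = R
sender m₃   = O
sender m₄   = R
sender a₁ᴼ  = O
sender r₁ᴼ  = O
sender r₁ᴿ  = R
sender a₂ᴼ  = TTP
sender a₂ᴿ  = TTP
sender r₂ᴼ  = TTP
sender r₂ᴿ  = TTP
sender reqᴼ = TTP

recipient : Msg → Agent
recipient m₁   = R
recipient m₂   = O
recipient m₃   = R
recipient m₄   = O
recipient a₁ᴼ  = TTP
recipient r₁ᴼ  = TTP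
recipient r₁ᴿ  = TTP
recipient a₂ᴼ  = O
recipient a₂ᴿ  = R
recipient r₂ᴼ  = O
recipient r₂ᴿ  = R
recipient reqᴼ = O

code : Msg → Fin 12
code m₁   = # 0
code m₂   = # 1
code m₃   = # 2
code m₄   = # 3
code a₁ᴼ  = # 4
code r₁ᴼ  = # 5
code r₁ᴿ  = # 6
code a₂ᴼ  = # 7
code a₂ᴿ  = # 8
code r₂ᴼ  = # 9
code r₂ᴿ  = # 10
code reqᴼ = # 11

catalogue : Vec Msg 12
catalogue =
  m₁ ∷ᵛ m₂ ∷ᵛ m₃ ∷ᵛ m₄ ∷ᵛ a₁ᴼ ∷ᵛ r₁ᴼ ∷ᵛ r₁ᴿ ∷ᵛ a₂ᴼ ∷ᵛ a₂ᴿ ∷ᵛ r₂ᴼ ∷ᵛ r₂ᴿ ∷ᵛ reqᴼ ∷ᵛ []ᵛ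

lookup-code : ∀ m → lookup catalogue (code m) ≡ m
lookup-code m₁   = refl
lookup-code m₂   = refl
lookup-code m₃   = refl
lookup-code m₄   = refl
lookup-code a₁ᴼ  = refl
lookup-code r₁ᴼ  = refl
lookup-code r₁ᴿ  = refl
lookup-code a₂ᴼ  = refl
lookup-code a₂ᴿ  = refl
lookup-code r₂ᴼ  = refl
lookup-code r₂ᴿ  = refl
lookup-code reqᴼ = refl

_≟ᵐ_ : DecidableEquality Msg
m ≟ᵐ m′ = map′
  (λ eq → trans (sym (lookup-code m)) (trans (cong (lookup catalogue) eq) (lookup-code m′)))
  (cong code)
  (code m Fin.≟ code m′)

open DecMembership _≟ᵐ_ using (_∈?_)

data Move : Set where
  ι         : Move
  send      : Msg → Move
  [a₂ᴼ,a₂ᴿ] : Move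
  [r₂ᴼ,r₂ᴿ] : Move

-- The order of a pair is unobservable: the channels may reorder messages.
messages : Move → List Msg
messages ι         = []
messages (send m)  = m ∷ []
messages [a₂ᴼ,a₂ᴿ] = a₂ᴼ ∷ a₂ᴿ ∷ []
messages [r₂ᴼ,r₂ᴿ] = r₂ᴼ ∷ r₂ᴿ ∷ []

data Event : Set where
  did : Move → Event
  got : Msg → Event

-- What a process has observed so far, the latest event first.
View : Set
View = List Event

outbox : View → List Msg
outbox = concatMap λ { (did mv) → messages mv ; (got _) → [] }

inbox : View → List Msg
inbox = concatMap λ { (did _) → [] ; (got m) → [ m ] }

sent : Msg → View → Bool
sent m v = does (m ∈? outbox v)

received : Msg → View → Bool
received m v = does (m ∈? inbox v)

-- Indexed by the process that sets them.
data Var : Agent → Set where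
  M₁ M₃ ABR-O RES-O EOR Sig-R-R Sig-R-TTP AB-O : Var O
  M₂ M₄ RES-R EOO Sig-O-O Sig-O-TTP AB-R       : Var R
  ABR RES A₂-O A₂-R R₂-O R₂-R                  : Var TTP

onSend : ∀ {p} → Msg → Var p → Bool
onSend m₁  M₁    = true
onSend m₃  M₃    = true
onSend a₁ᴼ ABR-O = true
onSend r₁ᴼ RES-O = true
onSend m₂  M₂    = true
onSend m₄  M₄    = true
onSend r₁ᴿ RES-R = true
onSend a₂ᴼ A₂-O  = true
onSend a₂ᴿ A₂-R  = true
onSend r₂ᴼ R₂-O  = true
onSend r₂ᴿ R₂-R  = true
onSend _   _     = false

onReceipt : ∀ {p} → Msg → Var p → Bool
onReceipt m₂  EOR       = true
onReceipt r₂ᴼ EOR       = true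
onReceipt m₄  Sig-R-R   = true
onReceipt r₂ᴼ Sig-R-TTP = true
onReceipt a₂ᴼ AB-O      = true
onReceipt m₁  EOO       = true
onReceipt r₂ᴿ EOO       = true
onReceipt m₃  Sig-O-O   = true
onReceipt r₂ᴿ Sig-O-TTP = true
onReceipt a₂ᴿ AB-R      = true
onReceipt a₁ᴼ ABR       = true
onReceipt r₁ᴼ RES       = true
onReceipt r₁ᴿ RES       = true
onReceipt _   _         = false

-- A variable is true as soon as one event has set it, and stays true.
value : ∀ {p} → View → Var p → Bool
value v x = any (λ m → onSend m x) (outbox v) ∨ any (λ m → onReceipt m x) (inbox v)

Valuation : Set
Valuation = ∀ p → Var p → Bool

Trace : Set
Trace = ℕ → Valuation

-- The moves available after each local view.  The variables of a process are
-- fixed by its agent, and the effect of a move by the move.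
Process : Set₁
Process = View → Pred Move 0ℓ

infix 4 _⪯_

_⪯_ : Process → Process → Set
P′ ⪯ P = ∀ v → Satisfiable (P′ v) × P′ v ⊆ P v

data Oᵍ (v : View) : Move → Set where
  idle    : Oᵍ v ι
  send-m₁ : Oᵍ v (send m₁)
  send-a₁ : Oᵍ v (send a₁ᴼ)
  send-m₃ : m₂ ∈ inbox v → Oᵍ v (send m₃)
  send-r₁ : m₂ ∈ inbox v → Oᵍ v (send r₁ᴼ)

data Rᵍ (v : View) : Move → Set where
  idle    : Rᵍ v ι
  send-m₂ : m₁ ∈ inbox v → Rᵍ v (send m₂)
  send-r₁ : m₁ ∈ inbox v → Rᵍ v (send r₁ᴿ)
  send-m₄ : m₃ ∈ inbox v → Rᵍ v (send m₄)

data Request : Set where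
  abortᴼ resolveᴼ resolveᴿ : Request

request : Event → List Request
request (got a₁ᴼ) = [ abortᴼ ]
request (got r₁ᴼ) = [ resolveᴼ ]
request (got r₁ᴿ) = [ resolveᴿ ]
request _         = []

-- In order of arrival, the first request first.
requests : View → List Request
requests []      = []
requests (e ∷ v) = requests v ++ request e

answers : List Move
answers = send a₂ᴼ ∷ send a₂ᴿ ∷ send r₂ᴼ ∷ send r₂ᴿ ∷ [a₂ᴼ,a₂ᴿ] ∷ [r₂ᴼ,r₂ᴿ] ∷ []

-- The flag tells whether the additional move reqᴼ belongs to the most general
-- third party.
data TTPᵍ (withReq : Bool) (v : View) : Move → Set where
  idle   : TTPᵍ withReq v ι
  answer : ∀ {q mv} → q ∈ requests v → mv ∈ answers → TTPᵍ withReq v mv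
  invite : ∀ {q} → T withReq → q ∈ requests v → TTPᵍ withReq v (send reqᴼ)

-- One turn: the scheduled process moves, then the channels deliver some
-- messages.  An arrival (k , m) is that of the copy of m sent at turn k;
-- arrivals are listed latest first.
record Turn : Set where
  field
    mover    : Agent
    move     : Move
    arrivals : List (ℕ × Msg)

open Turn public

Run : Set
Run = ℕ → Turn

local : Agent → Turn → View
local p s =
  concatMap (λ (_ , m) → if does (recipient m ≟ᵃ p) then [ got m ] else []) (arrivals s)
  ++ (if does (mover s ≟ᵃ p) then [ did (move s) ] else [])

view : Run → Agent → ℕ → View
view ρ p n = concatMap (local p) (applyDownFrom ρ n)

-- Schedulers see the past turns, the latest first.
Scheduler : Set
Scheduler = List Turn → Agent

_Schedules_ : Scheduler → Run → Set
Sc Schedules ρ = ∀ n → mover (ρ n) ≡ Sc (applyDownFrom ρ n)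

Fair : Scheduler → Set
Fair Sc = ∀ ρ → Sc Schedules ρ → ∀ p n → ∃[ k ] n ≤ k × mover (ρ k) ≡ p

Resilient : Msg → Set
Resilient m = sender m ≡ TTP ⊎ recipient m ≡ TTP

_SentAt_In_ : Msg → ℕ → Run → Set
m SentAt k In ρ = m ∈ messages (move (ρ k))

record Channels (ρ : Run) : Set where
  field
    genuine   : ∀ n {k m} → (k , m) ∈ arrivals (ρ n) → k ≤ n × m SentAt k In ρ
    once      : ∀ n → Unique (concatMap arrivals (applyDownFrom ρ n))
    resilient : ∀ k {m} → m SentAt k In ρ → Resilient m →
                ∃[ n ] (k , m) ∈ arrivals (ρ n)

team : Process → Process → Process → Agent → Process
team o r t O   = o
team o r t R   = r
team o r t TTP = t

record Plays (o r t : Process) (ρ : Run) : Set where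
  field
    scheduler : Scheduler
    fair      : Fair scheduler
    scheduled : scheduler Schedules ρ
    moves     : ∀ n → let p = mover (ρ n) in team o r t p (view ρ p n) (move (ρ n))
    channels  : Channels ρ

-- The eventualities that a reasonable third party meets; that it sends nothing
-- before a request is part of TTPᵍ.
record Reasonable (ρ : Run) : Set where
  field
    aborts   : ∀ n → head (requests (view ρ TTP n)) ≡ just abortᴼ →
               ∃[ k ] (a₂ᴼ SentAt k In ρ ⊎ a₂ᴿ SentAt k In ρ)
    resolves : ∀ n q → q ≡ resolveᴼ ⊎ q ≡ resolveᴿ →
               head (requests (view ρ TTP n)) ≡ just q →
               ∃[ k ] (r₂ᴼ SentAt k In ρ ⊎ r₂ᴿ SentAt k In ρ)

⟦_∥_∥_⟧ : Process → Process → Process → Pred Trace 0ℓ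
⟦ o ∥ r ∥ t ⟧ σ =
  ∃[ ρ ] Plays o r t ρ × Reasonable ρ × (∀ n p x → σ n p x ≡ value (view ρ p n) x)

_from_ : Trace → ℕ → Trace
(σ from n) i = σ (i + n)

□ : Pred Trace 0ℓ → Pred Trace 0ℓ
□ φ σ = ∀ n → φ (σ from n)

◇ : Pred Trace 0ℓ → Pred Trace 0ℓ
◇ φ σ = ∃[ n ] φ (σ from n)

⟨_⟩ : ∀ {p} → Var p → Pred Trace 0ℓ
⟨_⟩ {p} x σ = T (σ 0 p x)

φ-O : Pred Trace 0ℓ
φ-O =
  ◇ ⟨ M₁ ⟩
  ∩ □ ((◇ ⟨ Sig-R-R ⟩ ∪ (◇ ⟨ Sig-R-TTP ⟩ ∩ □ (∁ ⟨ AB-O ⟩)))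
       ∪ (◇ ⟨ AB-O ⟩ ∩ □ (∁ ⟨ Sig-O-O ⟩ ∩ ∁ ⟨ Sig-O-TTP ⟩)))

φ-R : Pred Trace 0ℓ
φ-R =
  □ (⟨ EOO ⟩ ⇒
      ((◇ ⟨ Sig-O-O ⟩ ∪ (◇ ⟨ Sig-O-TTP ⟩ ∩ □ (∁ ⟨ AB-R ⟩)))
       ∪ (◇ ⟨ AB-R ⟩ ∩ □ (∁ ⟨ Sig-R-R ⟩ ∩ ∁ ⟨ Sig-R-TTP ⟩))))

φ-TTP : Pred Trace 0ℓ
φ-TTP =
  □ ((⟨ ABR ⟩ ∪ ⟨ RES ⟩) ⇒
      (◇ ⟨ AB-O ⟩ ∪ ◇ ⟨ AB-R ⟩ ∪ ◇ ⟨ Sig-O-TTP ⟩ ∪ ◇ ⟨ Sig-R-TTP ⟩))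
  ∩ □ (⟨ Sig-O-TTP ⟩ ⇒ (◇ ⟨ Sig-R-TTP ⟩ ∩ □ (∁ ⟨ AB-O ⟩ ∩ ∁ ⟨ AB-R ⟩)))
  ∩ □ (⟨ Sig-R-TTP ⟩ ⇒ (◇ ⟨ Sig-O-TTP ⟩ ∩ □ (∁ ⟨ AB-O ⟩ ∩ ∁ ⟨ AB-R ⟩)))
  ∩ □ (⟨ AB-O ⟩ ⇒ (◇ ⟨ AB-R ⟩ ∩ □ (∁ ⟨ Sig-O-TTP ⟩ ∩ ∁ ⟨ Sig-R-TTP ⟩)))
  ∩ □ (⟨ AB-R ⟩ ⇒ (◇ ⟨ AB-O ⟩ ∩ □ (∁ ⟨ Sig-O-TTP ⟩ ∩ ∁ ⟨ Sig-R-TTP ⟩)))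

record Protocol : Set₁ where
  constructor protocol
  field
    O′ R′ TTP′ : Process

record P-AGS (withReq : Bool) (P : Protocol) : Set where
  open Protocol P
  field
    refines-O   : O′ ⪯ Oᵍ
    refines-R   : R′ ⪯ Rᵍ
    refines-TTP : TTP′ ⪯ TTPᵍ withReq
    -- A refinement of the reasonable third party is itself reasonable, so the
    -- filter on runs in ⟦_∥_∥_⟧ removes no behaviour of TTP′.
    reasonable  : ∀ ρ → Plays Oᵍ Rᵍ TTP′ ρ → Reasonable ρ
    condition₁  : ⟦ O′ ∥ Rᵍ ∥ TTPᵍ withReq ⟧ ⊆ (φ-R ∩ φ-TTP) ⇒ φ-O
    condition₂  : ⟦ Oᵍ ∥ R′ ∥ TTPᵍ withReq ⟧ ⊆ (φ-O ∩ φ-TTP) ⇒ φ-R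
    condition₃  : ⟦ Oᵍ ∥ Rᵍ ∥ TTP′ ⟧ ⊆ (φ-O ∩ φ-R) ⇒ φ-TTP
    condition₄  : ⟦ O′ ∥ R′ ∥ TTP′ ⟧ ⊆ φ-O ∩ φ-R ∩ φ-TTP

-- The move prescribed after a view, if any.
Rule : Set
Rule = View → Maybe Move

-- Idle turns since the last message the process sent.
waited : View → ℕ
waited []            = 0
waited (did ι ∷ v)   = suc (waited v)
waited (did _ ∷ v)   = 0
waited (got _ ∷ v)   = waited v

-- Those idle turns at which a move was prescribed.
overdue : Rule → View → ℕ
overdue rule []          = 0
overdue rule (did ι ∷ v) = if is-just (rule v) then suc (overdue rule v) else overdue rule v
overdue rule (did _ ∷ v) = 0
overdue rule (got _ ∷ v) = overdue rule v

-- A prescribed move may be put off for at most slack turns.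
data Follow (slack : ℕ) (rule : Rule) (v : View) : Move → Set where
  act   : ∀ {mv} → rule v ≡ just mv → Follow slack rule v mv
  delay : overdue rule v < slack → Follow slack rule v ι
  rest  : rule v ≡ nothing → Follow slack rule v ι

-- The numbers of idle turns after which m₂, m₃ and m₄ are late, and the slack
-- of each process.
record Timing : Set where
  field
    late₂ late₃ late₄ : ℕ
    slack             : Agent → ℕ

module _ (τ : Timing) where
  open Timing τ

  -- In a run m₃ is sent only after m₂ is received; the last test on m₂ makes
  -- r₁ᴼ composable at the other views as well.
  ruleO : Rule
  ruleO v =
    if not (sent m₁ v) then just (send m₁)
    else if sent a₁ᴼ v then nothing
    else if not (sent m₃ v) then
      (if received m₂ v then just (send m₃)
       else if late₂ ≤ᵇ waited v then just (send a₁ᴼ)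
       else nothing)
    else if received m₄ v ∨ sent r₁ᴼ v then nothing
    else if received m₂ v ∧ (late₄ ≤ᵇ waited v) then just (send r₁ᴼ)
    else nothing

  ruleR : Rule
  ruleR v =
    if not (received m₁ v) then nothing
    else if not (sent m₂ v) then just (send m₂)
    else if sent m₄ v ∨ sent r₁ᴿ v then nothing
    else if received m₃ v then just (send m₄)
    else if late₃ ≤ᵇ waited v then just (send r₁ᴿ)
    else nothing

  mainO mainR : Process
  mainO = Follow (slack O) ruleO
  mainR = Follow (slack R) ruleR

-- The reply to a request, given what the third party has done before.
Reply : Set
Reply = View → Request → Move

-- The requests still to be processed, the first one first.  An idle move
-- processes a request only if it is the reply to that request.
backlog : Reply → View → List Request
backlog reply []           = []
backlog reply (got m ∷ v)  = backlog reply v ++ request (got m)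
backlog reply (did mv ∷ v) with backlog reply v
... | []     = []
... | q ∷ qs with mv | reply v q
...   | ι | ι = qs
...   | ι | _ = q ∷ qs
...   | _ | _ = qs

ruleTTP : Reply → Rule
ruleTTP reply v with backlog reply v
... | []    = nothing
... | q ∷ _ = just (reply v q)

aborted recoveredR recovered : View → Bool
aborted    v = sent a₂ᴼ v ∨ sent a₂ᴿ v
recoveredR v = sent r₂ᴿ v
recovered  v = sent r₂ᴼ v ∨ sent r₂ᴿ v

replyKM replyASW replyGJM : Reply

replyKM v abortᴼ = if aborted v ∨ recovered v then ι else [a₂ᴼ,a₂ᴿ]
replyKM v _      = if aborted v ∨ recovered v then ι else [r₂ᴼ,r₂ᴿ]

replyASW v abortᴼ   = if recoveredR v then send reqᴼ else send a₂ᴼ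
replyASW v resolveᴼ = if aborted v then send a₂ᴼ else send r₂ᴼ
replyASW v resolveᴿ = if aborted v then send a₂ᴿ else send r₂ᴿ

replyGJM v abortᴼ   = if recovered v then send r₂ᴼ else send a₂ᴼ
replyGJM v resolveᴼ = if aborted v then send a₂ᴼ else send r₂ᴼ
replyGJM v resolveᴿ = if aborted v then send a₂ᴿ else send r₂ᴿ

corresponding : Reply → Timing → Protocol
corresponding reply τ =
  protocol (mainO τ) (mainR τ) (Follow (Timing.slack τ TTP) (ruleTTP reply))

P-KM P-ASW P-GJM : Timing → Protocol
P-KM  = corresponding replyKM
P-ASW = corresponding replyASW
P-GJM = corresponding replyGJM

-- KM: the only obligation of the other parties that matters to an agent is φ-TTP.
-- Each agent's rule forces it, within boundedly many of its turns, either to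
-- obtain the signature it is after or to put a request to the third party;
-- O never sends both a₁ᴼ and m₃, nor R both r₁ᴿ and m₄.  By φ-TTP the request is
-- settled the same way for both agents; when O asks to resolve, the first request
-- can only be a resolve request, so reasonableness rules out the abort tokens.
-- The KM third party speaks at most once, addressing both agents, so it meets
-- φ-TTP against any agents, and condition 4 follows from the other three because
-- plays are monotone in the processes.
--
-- ASW and GJM: in the run where m₁ is lost and O aborts, only O is sent an abort
-- token, which contradicts φ-TTP and hence condition 4.
module Submission where

open import Defs
open import Data.Bool using (Bool; true; false; not; _∧_; _∨_; if_then_else_; T)
import Data.Bool.Properties as Bool
open import Data.Bool.ListAction using (all)
open import Data.Empty using (⊥; ⊥-elim)
open import Data.List using (List; []; _∷_; _++_; [_]; map; concatMap; applyDownFrom; head; length; replicate)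
open import Data.List.Membership.Propositional using (find; lose) renaming (_∈_ to _∈ˡ_; _∉_ to _∉ˡ_)
open import Data.List.Membership.Propositional.Properties using (∈-++⁺ˡ; ∈-++⁺ʳ; ∈-++⁻)
import Data.List.Membership.DecPropositional as DecMembership
open import Data.List.Properties using (length-applyDownFrom; ++-identityʳ; ++-assoc)
import Data.List.Relation.Unary.All as All
open import Data.List.Relation.Unary.All using ([]; _∷_)
open import Data.List.Relation.Unary.All.Properties using (all⁺)
open import Data.List.Relation.Unary.AllPairs using ([]; _∷_)
open import Data.List.Relation.Unary.Any using (here; there)
open import Data.List.Relation.Unary.Any.Properties using (any⁺; any⁻)
open import Data.List.Relation.Unary.Unique.Propositional using (Unique)
open import Data.Maybe using (just; nothing)
open import Data.Nat using (ℕ; zero; suc; _+_; _∸_; _⊔_; _≤_; _<_; _≤ᵇ_; _≤′_; ≤′-refl; ≤′-step; z≤n; s≤s)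
open import Data.Nat.Properties
open import Data.Product as Prod using (_×_; _,_; proj₁; proj₂; ∃-syntax)
open import Data.Sum as Sum using (_⊎_; inj₁; inj₂)
open import Data.Unit using (⊤; tt)
open import Data.Vec using (toList)
open import Data.Vec.Membership.Propositional using () renaming (_∈_ to _∈ᵛ_)
open import Data.Vec.Membership.Propositional.Properties using (∈-toList⁺; ∈-lookup)
open import Function using (_∘_; id; Equivalence)
open import Level using (0ℓ)
open import Relation.Binary using (tri<; tri≈; tri>)
open import Relation.Binary.PropositionalEquality hiding ([_])
open import Relation.Nullary using (¬_; Dec; does; yes; no; contradiction)
open import Relation.Nullary.Decidable using (dec-true; dec-false)
open import Relation.Unary using (Pred; _∈_; _∉_; _⊆_; _∩_; ∁; _⇒_; Satisfiable)

open DecMembership _≟ᵐ_ using (_∈?_)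

-- Variables never turn false again, so `◇ ⟨ x ⟩` and `□ (∁ ⟨ x ⟩)` have the same truth value at
-- every suffix of a trace. The nested temporal formulas therefore flatten to `Eventually x` and
-- `Never x`, and these to membership in outboxes and inboxes. Safety is read off the guards of a
-- rule at the turn of sending. Liveness is the obstacle: neither scheduler nor channels obey a
-- bound, a prescribed move may be put off, and lateness is counted in own idle turns. A single
-- principle, `reach`, covers the originator, the recipient and the KM third party alike. The
-- negative half has to work for every `Timing`, so its run is built around `late₂` and uses none of
-- the slack. It must also be `Reasonable`, because the trace semantics keeps only such runs.

-- Views: membership tests, persistence, and the effect of one turn.

outbox-gots : ∀ ms v → outbox (map got ms ++ v) ≡ outbox v
outbox-gots []       v = refl
outbox-gots (_ ∷ ms) v = outbox-gots ms v

inbox-gots : ∀ ms v → inbox (map got ms ++ v) ≡ ms ++ inbox v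
inbox-gots []       v = refl
inbox-gots (m ∷ ms) v = cong (m ∷_) (inbox-gots ms v)

sent⇒∈ : ∀ {m} v → sent m v ≡ true → m ∈ˡ outbox v
sent⇒∈ {m} v eq with m ∈? outbox v
... | yes p = p

received⇒∈ : ∀ {m} v → received m v ≡ true → m ∈ˡ inbox v
received⇒∈ {m} v eq with m ∈? inbox v
... | yes p = p

∈⇒sent : ∀ {m} v → m ∈ˡ outbox v → sent m v ≡ true
∈⇒sent v = dec-true (_ ∈? outbox v)

∈⇒received : ∀ {m} v → m ∈ˡ inbox v → received m v ≡ true
∈⇒received v = dec-true (_ ∈? inbox v)

unsent⇒∉ : ∀ {m} v → sent m v ≡ false → m ∉ˡ outbox v
unsent⇒∉ v eq m∈ with () ← trans (sym eq) (∈⇒sent v m∈)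

Persistent : Pred View 0ℓ → Set
Persistent Q = ∀ e v → Q v → Q (e ∷ v)

persistent-++ : ∀ {Q} → Persistent Q → ∀ u {v} → Q v → Q (u ++ v)
persistent-++ stays []      q = q
persistent-++ stays (e ∷ u) q = stays e _ (persistent-++ stays u q)

persistent-view : ∀ {Q} → Persistent Q → ∀ {ρ p n k} → n ≤ k →
                  Q (view ρ p n) → Q (view ρ p k)
persistent-view {Q} stays {ρ} {p} = go ∘ ≤⇒≤′
  where
  go : ∀ {n k} → n ≤′ k → Q (view ρ p n) → Q (view ρ p k)
  go ≤′-refl               q = q
  go (≤′-step {n = k} n≤k) q = persistent-++ stays (local p (ρ k)) (go n≤k q)

outbox-persistent : ∀ {m} → Persistent (λ v → m ∈ˡ outbox v)
outbox-persistent (did mv) _ = ∈-++⁺ʳ (messages mv)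
outbox-persistent (got _)  _ = id

inbox-persistent : ∀ {m} → Persistent (λ v → m ∈ˡ inbox v)
inbox-persistent (did _) _ = id
inbox-persistent (got _) _ = there

head-persistent : ∀ {q} → Persistent (λ v → head (requests v) ≡ just q)
head-persistent e v eq with requests v
... | _ ∷ _ = eq

×-persistent : ∀ {P Q} → Persistent P → Persistent Q → Persistent (λ v → P v × Q v)
×-persistent P-stays Q-stays e v (p , q) = P-stays e v p , Q-stays e v q

⊎-persistent : ∀ {P Q} → Persistent P → Persistent Q → Persistent (λ v → P v ⊎ Q v)
⊎-persistent P-stays Q-stays e v (inj₁ p) = inj₁ (P-stays e v p)
⊎-persistent P-stays Q-stays e v (inj₂ q) = inj₂ (Q-stays e v q)

delivered : Agent → List (ℕ × Msg) → List Msg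
delivered p = concatMap λ (_ , m) → if does (recipient m ≟ᵃ p) then [ m ] else []

local-arrivals : ∀ p as →
  concatMap (λ (_ , m) → if does (recipient m ≟ᵃ p) then [ got m ] else []) as
  ≡ map got (delivered p as)
local-arrivals p []             = refl
local-arrivals p ((_ , m) ∷ as) with does (recipient m ≟ᵃ p)
... | true  = cong (got m ∷_) (local-arrivals p as)
... | false = local-arrivals p as

delivered⁻ : ∀ {p m} as → m ∈ˡ delivered p as → (∃[ k ] (k , m) ∈ˡ as) × recipient m ≡ p
delivered⁻ {p} ((k , m′) ∷ as) m∈ with recipient m′ ≟ᵃ p
delivered⁻ ((k , m′) ∷ as) (here refl) | yes eq = (k , here refl) , eq
delivered⁻ ((k , m′) ∷ as) (there m∈)  | yes _
  with (k , k∈) , eq ← delivered⁻ as m∈ = (k , there k∈) , eq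
delivered⁻ ((k , m′) ∷ as) m∈          | no _
  with (k , k∈) , eq ← delivered⁻ as m∈ = (k , there k∈) , eq

delivered⁺ : ∀ {k m} as → (k , m) ∈ˡ as → m ∈ˡ delivered (recipient m) as
delivered⁺ {m = m} (_ ∷ as) (here refl) with recipient m ≟ᵃ recipient m
... | yes _ = here refl
... | no ¬eq = contradiction refl ¬eq
delivered⁺ ((k′ , m′) ∷ as) (there m∈) = ∈-++⁺ʳ (if does (recipient m′ ≟ᵃ _) then [ m′ ] else []) (delivered⁺ as m∈)

module _ (ρ : Run) where

  view-mover : ∀ {p mv} n → mover (ρ n) ≡ p → move (ρ n) ≡ mv →
    view ρ p (suc n) ≡ map got (delivered p (arrivals (ρ n))) ++ did mv ∷ view ρ p n
  view-mover {p} n eq refl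
    rewrite local-arrivals p (arrivals (ρ n)) | dec-true (mover (ρ n) ≟ᵃ p) eq
    = ++-assoc (map got (delivered p (arrivals (ρ n)))) _ _

  view-other : ∀ {p} n → mover (ρ n) ≢ p →
    view ρ p (suc n) ≡ map got (delivered p (arrivals (ρ n))) ++ view ρ p n
  view-other {p} n neq
    rewrite local-arrivals p (arrivals (ρ n)) | dec-false (mover (ρ n) ≟ᵃ p) neq
    = ++-assoc (map got (delivered p (arrivals (ρ n)))) [] _

  outbox-mover : ∀ {p} n → mover (ρ n) ≡ p →
    outbox (view ρ p (suc n)) ≡ messages (move (ρ n)) ++ outbox (view ρ p n)
  outbox-mover n eq = trans (cong outbox (view-mover n eq refl)) (outbox-gots (delivered _ (arrivals (ρ n))) _)

  outbox-other : ∀ {p} n → mover (ρ n) ≢ p → outbox (view ρ p (suc n)) ≡ outbox (view ρ p n)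
  outbox-other n neq = trans (cong outbox (view-other n neq)) (outbox-gots (delivered _ (arrivals (ρ n))) _)

  outbox⁻ : ∀ {p m} n → m ∈ˡ outbox (view ρ p n) →
            ∃[ k ] mover (ρ k) ≡ p × m SentAt k In ρ
  outbox⁻ {p} {m} (suc n) m∈ = by-cases (mover (ρ n) ≟ᵃ p)
    where
    by-cases : Dec (mover (ρ n) ≡ p) → ∃[ k ] mover (ρ k) ≡ p × m SentAt k In ρ
    by-cases (no neq) = outbox⁻ n (subst (m ∈ˡ_) (outbox-other n neq) m∈)
    by-cases (yes eq) with ∈-++⁻ (messages (move (ρ n))) (subst (m ∈ˡ_) (outbox-mover n eq) m∈)
    ... | inj₁ now    = n , eq , now
    ... | inj₂ before = outbox⁻ n before

  outbox⁺ : ∀ {p m} n → mover (ρ n) ≡ p → m SentAt n In ρ → m ∈ˡ outbox (view ρ p (suc n))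
  outbox⁺ n eq m∈ = subst (_ ∈ˡ_) (sym (outbox-mover n eq)) (∈-++⁺ˡ m∈)

  inbox-turn : ∀ p n → inbox (view ρ p (suc n)) ≡ delivered p (arrivals (ρ n)) ++ inbox (view ρ p n)
  inbox-turn p n = by-cases (mover (ρ n) ≟ᵃ p)
    where
    by-cases : Dec (mover (ρ n) ≡ p) →
      inbox (view ρ p (suc n)) ≡ delivered p (arrivals (ρ n)) ++ inbox (view ρ p n)
    by-cases (yes eq) = trans (cong inbox (view-mover n eq refl)) (inbox-gots (delivered p (arrivals (ρ n))) _)
    by-cases (no neq) = trans (cong inbox (view-other n neq)) (inbox-gots (delivered p (arrivals (ρ n))) _)

  inbox⁻ : ∀ {p m} n → m ∈ˡ inbox (view ρ p n) →
           ∃[ k ] (∃[ j ] (j , m) ∈ˡ arrivals (ρ k)) × recipient m ≡ p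
  inbox⁻ {p} {m} (suc n) m∈
    with ∈-++⁻ (delivered p (arrivals (ρ n))) (subst (m ∈ˡ_) (inbox-turn p n) m∈)
  ... | inj₁ now    = n , delivered⁻ (arrivals (ρ n)) now
  ... | inj₂ before = inbox⁻ n before

  inbox⁺ : ∀ {j m} n → (j , m) ∈ˡ arrivals (ρ n) → m ∈ˡ inbox (view ρ (recipient m) (suc n))
  inbox⁺ {m = m} n jm∈ =
    subst (m ∈ˡ_) (sym (inbox-turn (recipient m) n)) (∈-++⁺ˡ (delivered⁺ (arrivals (ρ n)) jm∈))

-- From values of variables to messages sent and received.

value⁻ : ∀ {p} {x : Var p} v → T (value v x) →
         (∃[ m ] m ∈ˡ outbox v × T (onSend m x)) ⊎ (∃[ m ] m ∈ˡ inbox v × T (onReceipt m x))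
value⁻ v t with Equivalence.to Bool.T-∨ t
... | inj₁ s = inj₁ (find (any⁻ _ (outbox v) s))
... | inj₂ r = inj₂ (find (any⁻ _ (inbox v) r))

value-out⁺ : ∀ {p} {x : Var p} {m} v → m ∈ˡ outbox v → T (onSend m x) → T (value v x)
value-out⁺ v m∈ t = Equivalence.from Bool.T-∨ (inj₁ (any⁺ _ (lose m∈ t)))

value-in⁺ : ∀ {p} {x : Var p} {m} v → m ∈ˡ inbox v → T (onReceipt m x) → T (value v x)
value-in⁺ v m∈ t = Equivalence.from Bool.T-∨ (inj₂ (any⁺ _ (lose m∈ t)))

value-persistent : ∀ {p} {x : Var p} → Persistent (λ v → T (value v x))
value-persistent {x = x} e v t with value⁻ {x = x} v t
... | inj₁ (m , m∈ , s) = value-out⁺ (e ∷ v) (outbox-persistent e v m∈) s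
... | inj₂ (m , m∈ , s) = value-in⁺ (e ∷ v) (inbox-persistent e v m∈) s

settable : ∀ {p} → Var p → List Msg → Msg → Bool
settable x ms m = not (onSend m x) ∧ (not (onReceipt m x) ∨ does (m ∈? ms))

-- Decides by evaluation that x is set only on receipt, and only of the messages ms.
setBy : ∀ {p} → Var p → List Msg → Bool
setBy x ms = all (settable x ms) (toList catalogue)

setBy⁻ : ∀ {p} (x : Var p) ms → T (setBy x ms) → ∀ m →
         onSend m x ≡ false × (T (onReceipt m x) → m ∈ˡ ms)
setBy⁻ x ms set m
  with onSend m x | onReceipt m x | m ∈? ms
     -- Every message sits in the catalogue at position `code m`, so the evaluated check specialises
     -- to `m`; as the last scrutinee it refutes the Boolean cases left out below.
     | All.lookup (all⁺ (settable x ms) (toList catalogue) set)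
         (∈-toList⁺ (subst (λ m′ → m′ ∈ᵛ catalogue) (lookup-code m) (∈-lookup (code m) catalogue)))
... | false | true  | yes m∈ | _ = refl , λ _ → m∈
... | false | false | _      | _ = refl , λ ()

-- For concrete `x` and `ms` the hidden check evaluates to `⊤` and is filled in by unification;
-- callers with a variable message hand it on explicitly.
received⁻ : ∀ {p} (x : Var p) ms {_ : T (setBy x ms)} v → T (value v x) →
            ∃[ m ] m ∈ˡ ms × m ∈ˡ inbox v
received⁻ x ms {set} v t with value⁻ {x = x} v t
... | inj₁ (m , m∈ , s) = ⊥-elim (subst T (proj₁ (setBy⁻ x ms set m)) s)
... | inj₂ (m , m∈ , s) = m , proj₂ (setBy⁻ x ms set m) s , m∈

-- Safety and liveness of a process that follows a rule.

waited-gots : ∀ ms v → waited (map got ms ++ v) ≡ waited v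
waited-gots []       v = refl
waited-gots (_ ∷ ms) v = waited-gots ms v

overdue-gots : ∀ rule ms v → overdue rule (map got ms ++ v) ≡ overdue rule v
overdue-gots rule []       v = refl
overdue-gots rule (_ ∷ ms) v = overdue-gots rule ms v

overdue-prescribed : ∀ rule {mv} v → rule v ≡ just mv → overdue rule (did ι ∷ v) ≡ suc (overdue rule v)
overdue-prescribed rule v eq rewrite eq = refl

overdue-free : ∀ rule v → rule v ≡ nothing → overdue rule (did ι ∷ v) ≡ overdue rule v
overdue-free rule v eq rewrite eq = refl

Follow-sends : ∀ {s rule v mv m} → Follow s rule v mv → m ∈ˡ messages mv → rule v ≡ just mv
Follow-sends (act eq) _ = eq

Follow-rests : ∀ {s rule v mv} → Follow s rule v mv → rule v ≡ nothing → mv ≡ ι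
Follow-rests (act r)   r′ with () ← trans (sym r) r′
Follow-rests (delay _) _  = refl
Follow-rests (rest _)  _  = refl

-- The ways of being under way to `Q`. Under `waits` only `ι` is possible, and under `acts` anything
-- but `ι` already yields `Q`. Hence nothing is sent before `Q` holds, and `waited` is never reset
-- on the way.
data Stage (rule : Rule) (L : ℕ) (Q : Pred View 0ℓ) (v : View) : Set where
  reached : Q v → Stage rule L Q v
  waits   : rule v ≡ nothing → waited v < L → Stage rule L Q v
  acts    : ∀ {mv} → rule v ≡ just mv → Q (did mv ∷ v) → Stage rule L Q v

module Following {ρ : Run} {p : Agent} {s : ℕ} {rule : Rule}
  (turns   : ∀ n → ∃[ d ] mover (ρ (d + n)) ≡ p)
  (follows : ∀ n → mover (ρ n) ≡ p → Follow s rule (view ρ p n) (move (ρ n))) where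

  private
    vw : ℕ → View
    vw = view ρ p

  performed : ∀ {m} n → m ∈ˡ outbox (vw n) →
              ∃[ k ] mover (ρ k) ≡ p × rule (vw k) ≡ just (move (ρ k)) × m SentAt k In ρ
  performed n m∈ with k , eq , m∈k ← outbox⁻ ρ n m∈ = k , eq , Follow-sends (follows k eq) m∈k , m∈k

  -- Compare the turns at which the two messages are sent. The first guard excludes the same turn
  -- and an earlier `m′`, the second an earlier `m`; the views `n` and `n′` can then be arbitrary.
  exclusive : ∀ {m m′} →
    (∀ v {mv} → rule v ≡ just mv → m ∈ˡ messages mv → m′ ∉ˡ messages mv × m′ ∉ˡ outbox v) →
    (∀ v {mv} → rule v ≡ just mv → m′ ∈ˡ messages mv → m ∉ˡ outbox v) →
    ∀ n n′ → m ∈ˡ outbox (vw n) → m′ ∉ˡ outbox (vw n′)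
  exclusive first second n n′ m∈ m′∈
    with k , eq , prescribed , now ← performed n m∈ | k′ , eq′ , prescribed′ , now′ ← performed n′ m′∈
       | <-cmp k k′
  ... | tri< k<k′ _ _ = second _ prescribed′ now′ (persistent-view outbox-persistent k<k′ (outbox⁺ ρ k eq now))
  ... | tri≈ _ refl _ = proj₁ (first _ prescribed now) now′
  ... | tri> _ _ k′<k = proj₂ (first _ prescribed now) (persistent-view outbox-persistent k′<k (outbox⁺ ρ k′ eq′ now′))

  private
    after-idle : ∀ (f : View → ℕ) → (∀ ms v → f (map got ms ++ v) ≡ f v) →
                 ∀ n → mover (ρ n) ≡ p → move (ρ n) ≡ ι → f (vw (suc n)) ≡ f (did ι ∷ vw n)
    after-idle f f-gots n eq mv≡ =
      trans (cong f (view-mover ρ n eq mv≡)) (f-gots (delivered p (arrivals (ρ n))) _)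

    after-other : ∀ (f : View → ℕ) → (∀ ms v → f (map got ms ++ v) ≡ f v) →
                  ∀ n → mover (ρ n) ≢ p → f (vw (suc n)) ≡ f (vw n)
    after-other f f-gots n neq =
      trans (cong f (view-other ρ n neq)) (f-gots (delivered p (arrivals (ρ n))) _)

    ≤-spend : ∀ {l x y} a → l ≤ suc a + x → y ≡ suc x → l ≤ a + y
    ≤-spend {x = x} a l≤ refl = ≤-trans l≤ (≤-reflexive (sym (+-suc a x)))

    ≤-keep : ∀ {l x y} a → l ≤ a + x → x ≤ y → l ≤ a + y
    ≤-keep a l≤ x≤y = ≤-trans l≤ (+-monoʳ-≤ a x≤y)

  module _ {I Q : Pred View 0ℓ} (I-stays : Persistent I) (Q-stays : Persistent Q)
           (L : ℕ) (stage : ∀ v → I v → Stage rule L Q v) where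

    private
      Goal : Set
      Goal = ∃[ k ] I (vw k) × Q (vw k)

      -- Lexicographic descent: a bounds the waiting left, c the slack left, and
      -- d the number of turns before the next one of p.
      go : ∀ a c d n → L ≤ a + waited (vw n) → s ≤ c + overdue rule (vw n) →
           mover (ρ (d + n)) ≡ p → I (vw n) → Goal

      own : ∀ a c n mv → mover (ρ n) ≡ p → move (ρ n) ≡ mv → Follow s rule (vw n) mv →
            Stage rule L Q (vw n) → L ≤ a + waited (vw n) → s ≤ c + overdue rule (vw n) →
            I (vw n) → Goal
      own a c n mv eq mv≡ fl (reached q) La sc i = n , i , q
      own a c n mv eq mv≡ (act r) (acts r′ q) La sc i with refl ← trans (sym r) r′ =
        suc n , persistent-view I-stays (n≤1+n n) i ,
        subst Q (sym (view-mover ρ n eq mv≡))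
          (persistent-++ Q-stays (map got (delivered p (arrivals (ρ n)))) q)
      own a c n mv eq mv≡ (rest r) (acts r′ q) La sc i with () ← trans (sym r) r′
      -- An exhausted slack contradicts a further delay; in the same way an exhausted wait
      -- contradicts `waits` below.
      own a zero n .ι eq mv≡ (delay lt) (acts r′ q) La sc i = contradiction sc (<⇒≱ lt)
      -- A delayed turn is idle too, so `waited` grows as well, but only the slack is charged for
      -- it.
      own a (suc c) n .ι eq mv≡ (delay lt) (acts r′ q) La sc i with e , eq′ ← turns (suc n) =
        go a c e (suc n)
          (≤-keep a La (≤-trans (n≤1+n _) (≤-reflexive (sym (after-idle waited waited-gots n eq mv≡)))))
          (≤-spend c sc (trans (after-idle (overdue rule) (overdue-gots rule) n eq mv≡)
                               (overdue-prescribed rule (vw n) r′)))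
          eq′ (persistent-view I-stays (n≤1+n n) i)
      own a c n mv eq mv≡ (act r) (waits r′ w) La sc i with () ← trans (sym r) r′
      own zero c n mv eq mv≡ fl (waits r′ w) La sc i = contradiction La (<⇒≱ w)
      own (suc a) c n mv eq mv≡ fl (waits r′ w) La sc i with e , eq′ ← turns (suc n) =
        go a c e (suc n)
          (≤-spend a La (after-idle waited waited-gots n eq idles))
          (≤-keep c sc (≤-reflexive (sym (trans (after-idle (overdue rule) (overdue-gots rule) n eq idles)
                                               (overdue-free rule (vw n) r′)))))
          eq′ (persistent-view I-stays (n≤1+n n) i)
        where
        idles : move (ρ n) ≡ ι
        idles = trans mv≡ (Follow-rests fl r′)

      go a c d n La sc eqd i = by-cases d eqd (mover (ρ n) ≟ᵃ p)
        where
        by-cases : ∀ d → mover (ρ (d + n)) ≡ p → Dec (mover (ρ n) ≡ p) → Goal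
        by-cases d       eqd (yes eq) = own a c n _ eq refl (follows n eq) (stage (vw n) i) La sc i
        by-cases zero    eqd (no neq) = contradiction eqd neq
        by-cases (suc d) eqd (no neq) =
          go a c d (suc n)
            (≤-keep a La (≤-reflexive (sym (after-other waited waited-gots n neq))))
            (≤-keep c sc (≤-reflexive (sym (after-other (overdue rule) (overdue-gots rule) n neq))))
            (trans (cong (mover ∘ ρ) (+-suc d n)) eqd)
            (persistent-view I-stays (n≤1+n n) i)

    reach : ∀ n → I (vw n) → Goal
    reach n i with d , eq ← turns n = go L s d n (m≤m+n L _) (m≤m+n s _) eq i

Follow-refines : ∀ {s rule P} → (∀ {v} → P v ι) → (∀ v {mv} → rule v ≡ just mv → P v mv) →
                 Follow s rule ⪯ P
Follow-refines {s} {rule} {P} rests prescribed v = some (rule v) refl , sub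
  where
  some : ∀ r → rule v ≡ r → Satisfiable (Follow s rule v)
  some (just mv) eq = mv , act eq
  some nothing   eq = ι , rest eq
  sub : Follow s rule v ⊆ P v
  sub (act eq)  = prescribed v eq
  sub (delay _) = rests
  sub (rest _)  = rests

≰ᵇ⇒> : ∀ {m n} → (m ≤ᵇ n) ≡ false → n < m
≰ᵇ⇒> {m} {n} eq = ≰⇒> λ m≤n → subst T eq (≤⇒≤ᵇ m≤n)

-- The objectives as statements about a run.

module Temporal (ρ : Run) where

  Eventually Never : ∀ {p} → Var p → Set
  Eventually {p} x = ∃[ n ] T (value (view ρ p n) x)
  Never      {p} x = ∀ n → ¬ T (value (view ρ p n) x)

  value-later : ∀ {p} {x : Var p} {n k} → n ≤ k → T (value (view ρ p n) x) → T (value (view ρ p k) x)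
  value-later {x = x} = persistent-view (value-persistent {x = x})

  Triggers : ∀ {p q r s} → Var p → Var q → Var r → Var s → Set
  Triggers x y z w = Eventually x → Eventually y × Never z × Never w

  record Consistent : Set where
    field
      answered : Eventually ABR ⊎ Eventually RES →
                 Eventually AB-O ⊎ Eventually AB-R ⊎ Eventually Sig-O-TTP ⊎ Eventually Sig-R-TTP
      sig-O    : Triggers Sig-O-TTP Sig-R-TTP AB-O AB-R
      sig-R    : Triggers Sig-R-TTP Sig-O-TTP AB-O AB-R
      ab-O     : Triggers AB-O AB-R Sig-O-TTP Sig-R-TTP
      ab-R     : Triggers AB-R AB-O Sig-O-TTP Sig-R-TTP

  FairForO FairForR : Set
  FairForO = (Eventually Sig-R-R ⊎ (Eventually Sig-R-TTP × Never AB-O))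
           ⊎ (Eventually AB-O × Never Sig-O-O × Never Sig-O-TTP)
  FairForR = (Eventually Sig-O-O ⊎ (Eventually Sig-O-TTP × Never AB-R))
           ⊎ (Eventually AB-R × Never Sig-R-R × Never Sig-R-TTP)

  module _ {σ : Trace} (σ≡ : ∀ n p x → σ n p x ≡ value (view ρ p n) x) where

    ◇⁺ : ∀ {p} {x : Var p} n → Eventually x → ◇ ⟨ x ⟩ (σ from n)
    ◇⁺ {p} {x} n (k , t) = k , subst T (sym (σ≡ (k + n) p x)) (value-later {x = x} (m≤m+n k n) t)

    ◇⁻ : ∀ {p} {x : Var p} n → ◇ ⟨ x ⟩ (σ from n) → Eventually x
    ◇⁻ {p} {x} n (k , t) = k + n , subst T (σ≡ (k + n) p x) t

    □∁⁺ : ∀ {p} {x : Var p} n → Never x → □ (∁ ⟨ x ⟩) (σ from n)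
    □∁⁺ {p} {x} n never k t = never (k + n) (subst T (σ≡ (k + n) p x) t)

    -- Were `x` true at some turn `k`, it would still be true at `k + n`; so silence from `n` on is
    -- silence from the start.
    □∁⁻ : ∀ {p} {x : Var p} n → □ (∁ ⟨ x ⟩) (σ from n) → Never x
    □∁⁻ {p} {x} n never k t =
      never k (subst T (sym (σ≡ (k + n) p x)) (value-later {x = x} (m≤m+n k n) t))

    triggers⁺ : ∀ {p q r s} {x : Var p} {y : Var q} {z : Var r} {w : Var s} → Triggers x y z w →
                □ (⟨ x ⟩ ⇒ (◇ ⟨ y ⟩ ∩ □ (∁ ⟨ z ⟩ ∩ ∁ ⟨ w ⟩))) σ
    triggers⁺ {p} {x = x} {y} {z} {w} tr n t with ey , nz , nw ← tr (n , subst T (σ≡ n p x) t) =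
      ◇⁺ {x = y} n ey , λ k → □∁⁺ {x = z} n nz k , □∁⁺ {x = w} n nw k

    triggers⁻ : ∀ {p q r s} {x : Var p} {y : Var q} {z : Var r} {w : Var s} →
                □ (⟨ x ⟩ ⇒ (◇ ⟨ y ⟩ ∩ □ (∁ ⟨ z ⟩ ∩ ∁ ⟨ w ⟩))) σ → Triggers x y z w
    triggers⁻ {p} {x = x} {y} {z} {w} □φ (n , t) with ey , nn ← □φ n (subst T (sym (σ≡ n p x)) t) =
      ◇⁻ {x = y} n ey , □∁⁻ {x = z} n (proj₁ ∘ nn) , □∁⁻ {x = w} n (proj₂ ∘ nn)

    φ-TTP⁺ : Consistent → φ-TTP σ
    φ-TTP⁺ c = reply , triggers⁺ {x = Sig-O-TTP} {Sig-R-TTP} {AB-O} {AB-R} sig-O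
                     , triggers⁺ {x = Sig-R-TTP} {Sig-O-TTP} {AB-O} {AB-R} sig-R
                     , triggers⁺ {x = AB-O} {AB-R} {Sig-O-TTP} {Sig-R-TTP} ab-O
                     , triggers⁺ {x = AB-R} {AB-O} {Sig-O-TTP} {Sig-R-TTP} ab-R
      where
      open Consistent c
      reply : ∀ n → _
      reply n t with answered (Sum.map (λ t → n , subst T (σ≡ n _ ABR) t) (λ t → n , subst T (σ≡ n _ RES) t) t)
      ... | inj₁ e               = inj₁ (◇⁺ {x = AB-O} n e)
      ... | inj₂ (inj₁ e)        = inj₂ (inj₁ (◇⁺ {x = AB-R} n e))
      ... | inj₂ (inj₂ (inj₁ e)) = inj₂ (inj₂ (inj₁ (◇⁺ {x = Sig-O-TTP} n e)))
      ... | inj₂ (inj₂ (inj₂ e)) = inj₂ (inj₂ (inj₂ (◇⁺ {x = Sig-R-TTP} n e)))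

    φ-TTP⁻ : φ-TTP σ → Consistent
    φ-TTP⁻ (reply , sO , sR , aO , aR) = record
      { answered = λ where
          (inj₁ (n , t)) → lower n (reply n (inj₁ (subst T (sym (σ≡ n _ ABR)) t)))
          (inj₂ (n , t)) → lower n (reply n (inj₂ (subst T (sym (σ≡ n _ RES)) t)))
      ; sig-O = triggers⁻ {x = Sig-O-TTP} {Sig-R-TTP} {AB-O} {AB-R} sO
      ; sig-R = triggers⁻ {x = Sig-R-TTP} {Sig-O-TTP} {AB-O} {AB-R} sR
      ; ab-O  = triggers⁻ {x = AB-O} {AB-R} {Sig-O-TTP} {Sig-R-TTP} aO
      ; ab-R  = triggers⁻ {x = AB-R} {AB-O} {Sig-O-TTP} {Sig-R-TTP} aR
      }
      where
      lower : ∀ n → _ → _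
      lower n = Sum.map (◇⁻ {x = AB-O} n) (Sum.map (◇⁻ {x = AB-R} n)
                  (Sum.map (◇⁻ {x = Sig-O-TTP} n) (◇⁻ {x = Sig-R-TTP} n)))

    φ-O⁺ : Eventually M₁ → FairForO → φ-O σ
    φ-O⁺ (n , t) f = (n , subst T (sym (σ≡ n O M₁)) t) , λ n → Sum.map
      (Sum.map (◇⁺ {x = Sig-R-R} n) (Prod.map (◇⁺ {x = Sig-R-TTP} n) (□∁⁺ {x = AB-O} n)))
      (Prod.map (◇⁺ {x = AB-O} n) λ (a , b) k → □∁⁺ {x = Sig-O-O} n a k , □∁⁺ {x = Sig-O-TTP} n b k)
      f

    φ-R⁺ : (Eventually EOO → FairForR) → φ-R σ
    φ-R⁺ f n t = Sum.map
      (Sum.map (◇⁺ {x = Sig-O-O} n) (Prod.map (◇⁺ {x = Sig-O-TTP} n) (□∁⁺ {x = AB-R} n)))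
      (Prod.map (◇⁺ {x = AB-R} n) λ (a , b) k → □∁⁺ {x = Sig-R-R} n a k , □∁⁺ {x = Sig-R-TTP} n b k)
      (f (n , subst T (σ≡ n _ EOO) t))

-- Message exchange in plays of the most general processes.

-- `_SentAt_In_` does not record who moved. This recovers the mover from the message, so that
-- whatever was sent lies in the outbox of its designated sender.
composer : ∀ {b} p {v mv m} → team Oᵍ Rᵍ (TTPᵍ b) p v mv → m ∈ˡ messages mv → sender m ≡ p
composer O   send-m₁     (here refl) = refl
composer O   send-a₁     (here refl) = refl
composer O   (send-m₃ _) (here refl) = refl
composer O   (send-r₁ _) (here refl) = refl
composer R   (send-m₂ _) (here refl) = refl
composer R   (send-r₁ _) (here refl) = refl
composer R   (send-m₄ _) (here refl) = refl
composer TTP (answer _ (here refl))                 (here refl) = refl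
composer TTP (answer _ (there (here refl)))         (here refl) = refl
composer TTP (answer _ (there (there (here refl)))) (here refl) = refl
composer TTP (answer _ (there (there (there (here refl))))) (here refl) = refl
composer TTP (answer _ (there (there (there (there (here refl)))))) (here refl) = refl
composer TTP (answer _ (there (there (there (there (here refl)))))) (there (here refl)) = refl
composer TTP (answer _ (there (there (there (there (there (here refl))))))) (here refl) = refl
composer TTP (answer _ (there (there (there (there (there (here refl))))))) (there (here refl)) = refl
composer TTP (invite _ _) (here refl) = refl

Plays-mono : ∀ {o r t o′ r′ t′ ρ} → (∀ p {v} → team o r t p v ⊆ team o′ r′ t′ p v) →
             Plays o r t ρ → Plays o′ r′ t′ ρ
Plays-mono {ρ = ρ} sub plays = record
  { scheduler = scheduler ; fair = fair ; scheduled = scheduled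
  ; moves = λ n → sub (mover (ρ n)) (moves n) ; channels = channels }
  where open Plays plays

module Turns {o r t ρ} (plays : Plays o r t ρ) where
  open Plays plays

  turns : ∀ p n → ∃[ d ] mover (ρ (d + n)) ≡ p
  turns p n with k , n≤k , eq ← fair ρ scheduled p n =
    k ∸ n , trans (cong (mover ∘ ρ) (m∸n+n≡m n≤k)) eq

  follows : ∀ p n → mover (ρ n) ≡ p → team o r t p (view ρ p n) (move (ρ n))
  follows p n eq = subst (λ p → team o r t p (view ρ p n) (move (ρ n))) eq (moves n)

module Exchange {b ρ} (plays : Plays Oᵍ Rᵍ (TTPᵍ b) ρ) where
  open Plays plays
  open Channels channels
  open Temporal ρ

  SentAt⇒outbox : ∀ {m} k → m SentAt k In ρ → m ∈ˡ outbox (view ρ (sender m) (suc k))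
  SentAt⇒outbox k m∈ = outbox⁺ ρ k (sym (composer (mover (ρ k)) (moves k) m∈)) m∈

  heard : ∀ {p m} n → m ∈ˡ inbox (view ρ p n) → ∃[ k ] m ∈ˡ outbox (view ρ (sender m) k)
  heard n m∈ with k , (j , jm∈) , _ ← inbox⁻ ρ n m∈ = suc j , SentAt⇒outbox j (proj₂ (genuine k jm∈))

  arrives : ∀ {m} k → m SentAt k In ρ → Resilient m → ∃[ n ] m ∈ˡ inbox (view ρ (recipient m) n)
  arrives k m∈ res with n , km∈ ← resilient k m∈ res = suc n , inbox⁺ ρ n km∈

  delivers : ∀ {p m} n → m ∈ˡ outbox (view ρ p n) → Resilient m →
             ∃[ k ] m ∈ˡ inbox (view ρ (recipient m) k)
  delivers n m∈ res with k , _ , m∈k ← outbox⁻ ρ n m∈ = arrives k m∈k res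

-- What the main protocol guarantees of each agent.

-- Keeps just the guards of `ruleO` that are used later: receipt of `m₂` for composability, and the
-- mutual absence of `a₁ᴼ` and `m₃` for `exclusive`. `ActsR` does the same for the recipient, with
-- `r₁ᴿ` and `m₄`.
data ActsO (v : View) : Move → Set where
  act-m₁ : ActsO v (send m₁)
  act-m₃ : a₁ᴼ ∉ˡ outbox v → m₂ ∈ˡ inbox v → ActsO v (send m₃)
  act-a₁ : m₃ ∉ˡ outbox v → ActsO v (send a₁ᴼ)
  act-r₁ : m₂ ∈ˡ inbox v → ActsO v (send r₁ᴼ)

data ActsR (v : View) : Move → Set where
  act-m₂ : m₁ ∈ˡ inbox v → ActsR v (send m₂)
  act-m₄ : m₃ ∈ˡ inbox v → r₁ᴿ ∉ˡ outbox v → ActsR v (send m₄)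
  act-r₁ : m₁ ∈ˡ inbox v → m₄ ∉ˡ outbox v → ActsR v (send r₁ᴿ)

module _ (τ : Timing) where
  open Timing τ

  actsO : ∀ v {mv} → ruleO τ v ≡ just mv → ActsO v mv
  actsO v eq with sent m₁ v | sent a₁ᴼ v in sa | sent m₃ v in s3 | received m₂ v in r2
                  | late₂ ≤ᵇ waited v | received m₄ v | sent r₁ᴼ v | late₄ ≤ᵇ waited v
  actsO v refl | false | _     | _     | _     | _    | _     | _     | _    = act-m₁
  actsO v refl | true | false | false | true | _ | _ | _ | _ = act-m₃ (unsent⇒∉ v sa) (received⇒∈ v r2)
  actsO v refl | true | false | false | false | true | _ | _ | _ = act-a₁ (unsent⇒∉ v s3)
  actsO v refl | true | false | true | true | _ | false | false | true = act-r₁ (received⇒∈ v r2)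

  actsR : ∀ v {mv} → ruleR τ v ≡ just mv → ActsR v mv
  actsR v eq with received m₁ v in r1 | sent m₂ v | sent m₄ v in s4 | sent r₁ᴿ v in sr
                  | received m₃ v in r3 | late₃ ≤ᵇ waited v
  actsR v refl | true | false | _     | _     | _     | _    = act-m₂ (received⇒∈ v r1)
  actsR v refl | true | true  | false | false | true  | _    = act-m₄ (received⇒∈ v r3) (unsent⇒∉ v sr)
  actsR v refl | true | true  | false | false | false | true = act-r₁ (received⇒∈ v r1) (unsent⇒∉ v s4)

  ActsO⊆Oᵍ : ∀ {v} → ActsO v ⊆ Oᵍ v
  ActsO⊆Oᵍ act-m₁        = send-m₁
  ActsO⊆Oᵍ (act-m₃ _ m∈) = send-m₃ m∈
  ActsO⊆Oᵍ (act-a₁ _)    = send-a₁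
  ActsO⊆Oᵍ (act-r₁ m∈)   = send-r₁ m∈

  ActsR⊆Rᵍ : ∀ {v} → ActsR v ⊆ Rᵍ v
  ActsR⊆Rᵍ (act-m₂ m∈)   = send-m₂ m∈
  ActsR⊆Rᵍ (act-m₄ m∈ _) = send-m₄ m∈
  ActsR⊆Rᵍ (act-r₁ m∈ _) = send-r₁ m∈

  mainO⪯Oᵍ : mainO τ ⪯ Oᵍ
  mainO⪯Oᵍ = Follow-refines Oᵍ.idle (λ v → ActsO⊆Oᵍ ∘ actsO v)

  mainR⪯Rᵍ : mainR τ ⪯ Rᵍ
  mainR⪯Rᵍ = Follow-refines Rᵍ.idle (λ v → ActsR⊆Rᵍ ∘ actsR v)

  stage-m₁ : ∀ v → Stage (ruleO τ) 0 (λ v → m₁ ∈ˡ outbox v) v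
  stage-m₁ v = by-cases (sent m₁ v) refl
    where
    by-cases : ∀ b → sent m₁ v ≡ b → Stage (ruleO τ) 0 (λ v → m₁ ∈ˡ outbox v) v
    by-cases true  s1 = reached (sent⇒∈ v s1)
    by-cases false s1 = acts prescribed (here refl)
      where
      prescribed : ruleO τ v ≡ just (send m₁)
      prescribed rewrite s1 = refl

  A₁orM₃ : Pred View 0ℓ
  A₁orM₃ v = a₁ᴼ ∈ˡ outbox v ⊎ m₃ ∈ˡ outbox v

  stage-m₃ : ∀ v → m₁ ∈ˡ outbox v → Stage (ruleO τ) late₂ A₁orM₃ v
  stage-m₃ v m₁∈ = by-cases (sent a₁ᴼ v) (sent m₃ v) (received m₂ v) (late₂ ≤ᵇ waited v) refl refl refl refl
    where
    s1 = ∈⇒sent v m₁∈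
    by-cases : ∀ a b c d → sent a₁ᴼ v ≡ a → sent m₃ v ≡ b → received m₂ v ≡ c →
               (late₂ ≤ᵇ waited v) ≡ d → Stage (ruleO τ) late₂ A₁orM₃ v
    by-cases true _ _ _ sa _ _ _ = reached (inj₁ (sent⇒∈ v sa))
    by-cases false true _ _ _ s3 _ _ = reached (inj₂ (sent⇒∈ v s3))
    by-cases false false true _ sa s3 r2 _ = acts prescribed (inj₂ (here refl))
      where
      prescribed : ruleO τ v ≡ just (send m₃)
      prescribed rewrite s1 | sa | s3 | r2 = refl
    by-cases false false false true sa s3 r2 l = acts prescribed (inj₁ (here refl))
      where
      prescribed : ruleO τ v ≡ just (send a₁ᴼ)
      prescribed rewrite s1 | sa | s3 | r2 | l = refl
    by-cases false false false false sa s3 r2 l = waits prescribed (≰ᵇ⇒> l)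
      where
      prescribed : ruleO τ v ≡ nothing
      prescribed rewrite s1 | sa | s3 | r2 | l = refl

  -- After `a₁ᴼ` the rule prescribes nothing however long the wait, so that case has to count as a
  -- goal; `outcomeO` discards it because `m₃` has been sent. The invariant contains `m₂` because
  -- `r₁ᴼ` is prescribed only once `m₂` has arrived.
  M₁M₂M₃ A₁orM₄orR₁ : Pred View 0ℓ
  M₁M₂M₃ v     = m₁ ∈ˡ outbox v × m₂ ∈ˡ inbox v × m₃ ∈ˡ outbox v
  A₁orM₄orR₁ v = a₁ᴼ ∈ˡ outbox v ⊎ m₄ ∈ˡ inbox v ⊎ r₁ᴼ ∈ˡ outbox v

  stage-m₄ : ∀ v → M₁M₂M₃ v → Stage (ruleO τ) late₄ A₁orM₄orR₁ v
  stage-m₄ v (m₁∈ , m₂∈ , m₃∈) =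
    by-cases (sent a₁ᴼ v) (received m₄ v) (sent r₁ᴼ v) (late₄ ≤ᵇ waited v) refl refl refl refl
    where
    s1 = ∈⇒sent v m₁∈
    r2 = ∈⇒received v m₂∈
    s3 = ∈⇒sent v m₃∈
    by-cases : ∀ a b c d → sent a₁ᴼ v ≡ a → received m₄ v ≡ b → sent r₁ᴼ v ≡ c →
               (late₄ ≤ᵇ waited v) ≡ d → Stage (ruleO τ) late₄ A₁orM₄orR₁ v
    by-cases true _ _ _ sa _ _ _ = reached (inj₁ (sent⇒∈ v sa))
    by-cases false true _ _ _ r4 _ _ = reached (inj₂ (inj₁ (received⇒∈ v r4)))
    by-cases false false true _ _ _ sr _ = reached (inj₂ (inj₂ (sent⇒∈ v sr)))
    by-cases false false false true sa r4 sr l = acts prescribed (inj₂ (inj₂ (here refl)))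
      where
      prescribed : ruleO τ v ≡ just (send r₁ᴼ)
      prescribed rewrite s1 | sa | s3 | r4 | sr | r2 | l = refl
    by-cases false false false false sa r4 sr l = waits prescribed (≰ᵇ⇒> l)
      where
      prescribed : ruleO τ v ≡ nothing
      prescribed rewrite s1 | sa | s3 | r4 | sr | r2 | l = refl

  stage-m₂ : ∀ v → m₁ ∈ˡ inbox v → Stage (ruleR τ) 0 (λ v → m₂ ∈ˡ outbox v) v
  stage-m₂ v m₁∈ = by-cases (sent m₂ v) refl
    where
    r1 = ∈⇒received v m₁∈
    by-cases : ∀ b → sent m₂ v ≡ b → Stage (ruleR τ) 0 (λ v → m₂ ∈ˡ outbox v) v
    by-cases true  s2 = reached (sent⇒∈ v s2)
    by-cases false s2 = acts prescribed (here refl)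
      where
      prescribed : ruleR τ v ≡ just (send m₂)
      prescribed rewrite r1 | s2 = refl

  M₁M₂ M₃orM₄orR₁ : Pred View 0ℓ
  M₁M₂ v       = m₁ ∈ˡ inbox v × m₂ ∈ˡ outbox v
  M₃orM₄orR₁ v = m₃ ∈ˡ inbox v ⊎ m₄ ∈ˡ outbox v ⊎ r₁ᴿ ∈ˡ outbox v

  stage-r₁ : ∀ v → M₁M₂ v → Stage (ruleR τ) late₃ M₃orM₄orR₁ v
  stage-r₁ v (m₁∈ , m₂∈) =
    by-cases (received m₃ v) (sent m₄ v) (sent r₁ᴿ v) (late₃ ≤ᵇ waited v) refl refl refl refl
    where
    r1 = ∈⇒received v m₁∈
    s2 = ∈⇒sent v m₂∈
    by-cases : ∀ a b c d → received m₃ v ≡ a → sent m₄ v ≡ b → sent r₁ᴿ v ≡ c →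
               (late₃ ≤ᵇ waited v) ≡ d → Stage (ruleR τ) late₃ M₃orM₄orR₁ v
    by-cases true _ _ _ r3 _ _ _ = reached (inj₁ (received⇒∈ v r3))
    by-cases false true _ _ _ s4 _ _ = reached (inj₂ (inj₁ (sent⇒∈ v s4)))
    by-cases false false true _ _ _ sr _ = reached (inj₂ (inj₂ (sent⇒∈ v sr)))
    by-cases false false false true r3 s4 sr l = acts prescribed (inj₂ (inj₂ (here refl)))
      where
      prescribed : ruleR τ v ≡ just (send r₁ᴿ)
      prescribed rewrite r1 | s2 | s4 | sr | r3 | l = refl
    by-cases false false false false r3 s4 sr l = waits prescribed (≰ᵇ⇒> l)
      where
      prescribed : ruleR τ v ≡ nothing
      prescribed rewrite r1 | s2 | s4 | sr | r3 | l = refl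

  module Originator {ρ s} (turns : ∀ n → ∃[ d ] mover (ρ (d + n)) ≡ O)
    (follows : ∀ n → mover (ρ n) ≡ O → Follow s (ruleO τ) (view ρ O n) (move (ρ n))) where
    open Following {ρ} {O} {s} {ruleO τ} turns follows

    a₁⇒¬m₃ : ∀ n n′ → a₁ᴼ ∈ˡ outbox (view ρ O n) → m₃ ∉ˡ outbox (view ρ O n′)
    a₁⇒¬m₃ = exclusive
      (λ v eq a₁∈ → after-a₁ (actsO v eq) a₁∈)
      (λ v eq m₃∈ → after-m₃ (actsO v eq) m₃∈)
      where
      after-a₁ : ∀ {v mv} → ActsO v mv → a₁ᴼ ∈ˡ messages mv → m₃ ∉ˡ messages mv × m₃ ∉ˡ outbox v
      after-a₁ (act-a₁ m₃∉) (here refl) = (λ { (here ()) }) , m₃∉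
      after-a₁ act-m₁       (here ())
      after-a₁ (act-m₃ _ _) (here ())
      after-a₁ (act-r₁ _)   (here ())
      after-m₃ : ∀ {v mv} → ActsO v mv → m₃ ∈ˡ messages mv → a₁ᴼ ∉ˡ outbox v
      after-m₃ (act-m₃ a₁∉ _) (here refl) = a₁∉
      after-m₃ act-m₁     (here ())
      after-m₃ (act-a₁ _) (here ())
      after-m₃ (act-r₁ _) (here ())

    m₃⇒m₂ : ∀ n → m₃ ∈ˡ outbox (view ρ O n) → ∃[ k ] m₂ ∈ˡ inbox (view ρ O k)
    m₃⇒m₂ n m₃∈ with k , _ , eq , now ← performed n m₃∈ = k , composed (actsO (view ρ O k) eq) now
      where
      composed : ∀ {v mv} → ActsO v mv → m₃ ∈ˡ messages mv → m₂ ∈ˡ inbox v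
      composed (act-m₃ _ m₂∈) (here refl) = m₂∈
      composed act-m₁     (here ())
      composed (act-a₁ _) (here ())
      composed (act-r₁ _) (here ())

    sends-m₁ : ∃[ n ] m₁ ∈ˡ outbox (view ρ O n)
    sends-m₁ with n , _ , m₁∈ ← reach {I = λ _ → ⊤} (λ _ _ _ → tt) outbox-persistent 0 (λ v _ → stage-m₁ v) 0 tt
      = n , m₁∈

    outcomeO : (∃[ n ] a₁ᴼ ∈ˡ outbox (view ρ O n)) × (∀ n → m₃ ∉ˡ outbox (view ρ O n))
             ⊎ (∀ n → a₁ᴼ ∉ˡ outbox (view ρ O n)) × ∃[ n ] (m₄ ∈ˡ inbox (view ρ O n) ⊎ r₁ᴼ ∈ˡ outbox (view ρ O n))
    outcomeO
      with n , m₁∈ ← sends-m₁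
      with reach outbox-persistent (⊎-persistent outbox-persistent outbox-persistent) late₂ stage-m₃ n m₁∈
    ... | k , m₁∈k , inj₁ a₁∈ = inj₁ ((k , a₁∈) , λ n → a₁⇒¬m₃ k n a₁∈)
    ... | k , m₁∈k , inj₂ m₃∈
      with j , m₂∈ ← m₃⇒m₂ k m₃∈
      -- `m₃⇒m₂` does not compare its turn with `k`; at `j ⊔ k` all three facts of the invariant
      -- hold.
      with reach
        (×-persistent outbox-persistent (×-persistent inbox-persistent outbox-persistent))
        (⊎-persistent outbox-persistent (⊎-persistent inbox-persistent outbox-persistent))
        late₄ stage-m₄ (j ⊔ k)
        ( persistent-view outbox-persistent (m≤n⊔m j k) m₁∈k
        , persistent-view inbox-persistent (m≤m⊔n j k) m₂∈
        , persistent-view outbox-persistent (m≤n⊔m j k) m₃∈ )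
    ...   | i , _ , inj₁ a₁∈ = ⊥-elim (a₁⇒¬m₃ i k a₁∈ m₃∈)
    ...   | i , _ , inj₂ q = inj₂ ((λ n a₁∈ → a₁⇒¬m₃ n k a₁∈ m₃∈) , i , q)

  module Recipient {ρ s} (turns : ∀ n → ∃[ d ] mover (ρ (d + n)) ≡ R)
    (follows : ∀ n → mover (ρ n) ≡ R → Follow s (ruleR τ) (view ρ R n) (move (ρ n))) where
    open Following {ρ} {R} {s} {ruleR τ} turns follows

    r₁⇒¬m₄ : ∀ n n′ → r₁ᴿ ∈ˡ outbox (view ρ R n) → m₄ ∉ˡ outbox (view ρ R n′)
    r₁⇒¬m₄ = exclusive
      (λ v eq r₁∈ → after-r₁ (actsR v eq) r₁∈)
      (λ v eq m₄∈ → after-m₄ (actsR v eq) m₄∈)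
      where
      after-r₁ : ∀ {v mv} → ActsR v mv → r₁ᴿ ∈ˡ messages mv → m₄ ∉ˡ messages mv × m₄ ∉ˡ outbox v
      after-r₁ (act-r₁ _ m₄∉) (here refl) = (λ { (here ()) }) , m₄∉
      after-r₁ (act-m₂ _)     (here ())
      after-r₁ (act-m₄ _ _)   (here ())
      after-m₄ : ∀ {v mv} → ActsR v mv → m₄ ∈ˡ messages mv → r₁ᴿ ∉ˡ outbox v
      after-m₄ (act-m₄ _ r₁∉) (here refl) = r₁∉
      after-m₄ (act-m₂ _)     (here ())
      after-m₄ (act-r₁ _ _)   (here ())

    m₄⇒m₃ : ∀ n → m₄ ∈ˡ outbox (view ρ R n) → ∃[ k ] m₃ ∈ˡ inbox (view ρ R k)
    m₄⇒m₃ n m₄∈ with k , _ , eq , now ← performed n m₄∈ = k , composed (actsR (view ρ R k) eq) now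
      where
      composed : ∀ {v mv} → ActsR v mv → m₄ ∈ˡ messages mv → m₃ ∈ˡ inbox v
      composed (act-m₄ m₃∈ _) (here refl) = m₃∈
      composed (act-m₂ _)     (here ())
      composed (act-r₁ _ _)   (here ())

    outcomeR : ∀ n → m₁ ∈ˡ inbox (view ρ R n) →
               (∃[ k ] m₃ ∈ˡ inbox (view ρ R k))
             ⊎ (∃[ k ] r₁ᴿ ∈ˡ outbox (view ρ R k)) × (∀ k → m₄ ∉ˡ outbox (view ρ R k))
    outcomeR n m₁∈
      with k , m₁m₂∈ ← reach inbox-persistent outbox-persistent 0 stage-m₂ n m₁∈
      with reach (×-persistent inbox-persistent outbox-persistent)
             (⊎-persistent inbox-persistent (⊎-persistent outbox-persistent outbox-persistent))
             late₃ stage-r₁ k m₁m₂∈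
    ... | i , _ , inj₁ m₃∈        = inj₁ (i , m₃∈)
    -- Sending `m₄` presupposes the receipt of `m₃`, which already is the originator's signature.
    ... | i , _ , inj₂ (inj₁ m₄∈) = inj₁ (m₄⇒m₃ i m₄∈)
    ... | i , _ , inj₂ (inj₂ r₁∈) = inj₂ ((i , r₁∈) , λ k → r₁⇒¬m₄ i k r₁∈)

-- Fairness for each agent under a consistent third party.

request⁻ : ∀ v {q} → q ∈ˡ requests v → ∃[ m ] m ∈ˡ inbox v × q ∈ˡ request (got m)
request⁻ (did _ ∷ v) q∈ with inj₁ q∈v ← ∈-++⁻ (requests v) q∈ = request⁻ v q∈v
request⁻ (got m ∷ v) q∈ with ∈-++⁻ (requests v) q∈
... | inj₂ q∈m = m , here refl , q∈m
... | inj₁ q∈v with m′ , m′∈ , q∈m′ ← request⁻ v q∈v = m′ , there m′∈ , q∈m′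

request⁺ : ∀ v {q m} → m ∈ˡ inbox v → q ∈ˡ request (got m) → q ∈ˡ requests v
request⁺ (did _ ∷ v) m∈          q∈ = ∈-++⁺ˡ (request⁺ v m∈ q∈)
request⁺ (got _ ∷ v) (here refl) q∈ = ∈-++⁺ʳ (requests v) q∈
request⁺ (got _ ∷ v) (there m∈)  q∈ = ∈-++⁺ˡ (request⁺ v m∈ q∈)

abort⁻ : ∀ v → abortᴼ ∈ˡ requests v → a₁ᴼ ∈ˡ inbox v
abort⁻ v q∈ with request⁻ v q∈
... | a₁ᴼ , m∈ , _          = m∈
... | r₁ᴼ , _  , here ()
... | r₁ᴿ , _  , here ()

head⁺ : ∀ {q} {qs : List Request} → q ∈ˡ qs → ∃[ q′ ] head qs ≡ just q′ × q′ ∈ˡ qs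
head⁺ {qs = q ∷ _} _ = q , refl , here refl

module Fairness {b ρ} (plays : Plays Oᵍ Rᵍ (TTPᵍ b) ρ) (consistent : Temporal.Consistent ρ) where
  open Temporal ρ
  open Exchange plays
  open Consistent consistent

  -- Each of the four possible answers forces its twin at the other agent and excludes both answers
  -- of the opposite kind, so only two joint outcomes remain.
  settles : Eventually ABR ⊎ Eventually RES →
            (Eventually AB-O × Eventually AB-R × Never Sig-O-TTP × Never Sig-R-TTP)
          ⊎ (Eventually Sig-O-TTP × Eventually Sig-R-TTP × Never AB-O × Never AB-R)
  settles asked with answered asked
  ... | inj₁ e               with e′ , ns ← ab-O e  = inj₁ (e , e′ , ns)
  ... | inj₂ (inj₁ e)        with e′ , ns ← ab-R e  = inj₁ (e′ , e , ns)
  ... | inj₂ (inj₂ (inj₁ e)) with e′ , ns ← sig-O e = inj₂ (e , e′ , ns)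
  ... | inj₂ (inj₂ (inj₂ e)) with e′ , ns ← sig-R e = inj₂ (e′ , e , ns)

  fairForO : Reasonable ρ →
    (∃[ n ] a₁ᴼ ∈ˡ outbox (view ρ O n)) × (∀ n → m₃ ∉ˡ outbox (view ρ O n))
    ⊎ (∀ n → a₁ᴼ ∉ˡ outbox (view ρ O n)) × ∃[ n ] (m₄ ∈ˡ inbox (view ρ O n) ⊎ r₁ᴼ ∈ˡ outbox (view ρ O n)) →
    FairForO
  fairForO _ (inj₁ ((n , a₁∈) , m₃∉)) with k , a₁∈k ← delivers n a₁∈ (inj₂ refl)
    with settles (inj₁ (k , value-in⁺ {x = ABR} (view ρ TTP k) a₁∈k tt))
  ... | inj₂ (_ , e , n , _)       = inj₁ (inj₂ (e , n))
  ... | inj₁ (e , _ , n , _) = inj₂ (e , ¬sig , n)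
    where
    ¬sig : Never Sig-O-O
    ¬sig k t with .m₃ , here refl , m₃∈ ← received⁻ Sig-O-O (m₃ ∷ []) (view ρ R k) t
      with j , m₃∈j ← heard k m₃∈ = m₃∉ j m₃∈j
  fairForO _ (inj₂ (_ , n , inj₁ m₄∈)) = inj₁ (inj₁ (n , value-in⁺ {x = Sig-R-R} (view ρ O n) m₄∈ tt))
  -- `settles` is too weak here: the rule asks for `r₁ᴼ` only after sending `m₃`, so an abort could
  -- leave the recipient holding the originator's signature.
  fairForO reasonable (inj₂ (a₁∉ , n , inj₂ r₁∈)) with k , r₁∈k ← delivers n r₁∈ (inj₂ refl)
    with q , first , q∈ ← head⁺ (request⁺ (view ρ TTP k) r₁∈k (here refl)) = inj₁ (inj₂ (resolved q first q∈))
    where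
    open Reasonable reasonable
    signed : ∃[ j ] (r₂ᴼ SentAt j In ρ ⊎ r₂ᴿ SentAt j In ρ) → Eventually Sig-R-TTP × Never AB-O
    signed (j , inj₁ r₂∈) with i , r₂∈i ← arrives j r₂∈ (inj₁ refl)
      with e ← (i , value-in⁺ {x = Sig-R-TTP} (view ρ O i) r₂∈i tt) = e , proj₁ (proj₂ (sig-R e))
    -- Reasonableness may provide only the replacement addressed to the recipient; `sig-O` turns it
    -- into one for the originator.
    signed (j , inj₂ r₂∈) with i , r₂∈i ← arrives j r₂∈ (inj₁ refl)
      with e , n , _ ← sig-O (i , value-in⁺ {x = Sig-O-TTP} (view ρ R i) r₂∈i tt) = e , n
    resolved : ∀ q → head (requests (view ρ TTP k)) ≡ just q → q ∈ˡ requests (view ρ TTP k) →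
               Eventually Sig-R-TTP × Never AB-O
    resolved abortᴼ _ q∈ with j , a₁∈ ← heard k (abort⁻ (view ρ TTP k) q∈) = ⊥-elim (a₁∉ j a₁∈)
    resolved resolveᴼ first _ = signed (resolves k resolveᴼ (inj₁ refl) first)
    resolved resolveᴿ first _ = signed (resolves k resolveᴿ (inj₂ refl) first)

  fairForR :
    (∀ n → m₁ ∈ˡ inbox (view ρ R n) →
     (∃[ k ] m₃ ∈ˡ inbox (view ρ R k))
     ⊎ (∃[ k ] r₁ᴿ ∈ˡ outbox (view ρ R k)) × (∀ k → m₄ ∉ˡ outbox (view ρ R k))) →
    Eventually EOO → FairForR
  fairForR outcome (n , t) with received⁻ EOO (m₁ ∷ r₂ᴿ ∷ []) (view ρ R n) t
  ... | .r₂ᴿ , there (here refl) , r₂∈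
    with e ← (n , value-in⁺ {x = Sig-O-TTP} (view ρ R n) r₂∈ tt) = inj₁ (inj₂ (e , proj₂ (proj₂ (sig-O e))))
  ... | .m₁ , here refl , m₁∈ with outcome n m₁∈
  ...   | inj₁ (k , m₃∈) = inj₁ (inj₁ (k , value-in⁺ {x = Sig-O-O} (view ρ R k) m₃∈ tt))
  ...   | inj₂ ((j , r₁∈) , m₄∉) with k , r₁∈k ← delivers j r₁∈ (inj₂ refl)
    with settles (inj₂ (k , value-in⁺ {x = RES} (view ρ TTP k) r₁∈k tt))
  ...     | inj₂ (e , _ , _ , n) = inj₁ (inj₂ (e , n))
  ...     | inj₁ (_ , e , _ , n) = inj₂ (e , ¬sig , n)
    where
    ¬sig : Never Sig-R-R
    ¬sig k t with .m₄ , here refl , m₄∈ ← received⁻ Sig-R-R (m₄ ∷ []) (view ρ O k) t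
      with j , m₄∈j ← heard k m₄∈ = m₄∉ j m₄∈j

-- The Kremer-Markowitch third party.

verdict : Request → Move
verdict abortᴼ   = [a₂ᴼ,a₂ᴿ]
verdict resolveᴼ = [r₂ᴼ,r₂ᴿ]
verdict resolveᴿ = [r₂ᴼ,r₂ᴿ]

verdict-answer : ∀ q → verdict q ∈ˡ answers
verdict-answer abortᴼ   = there (there (there (there (here refl))))
verdict-answer resolveᴼ = there (there (there (there (there (here refl)))))
verdict-answer resolveᴿ = there (there (there (there (there (here refl)))))

a₂∌r₂ : ∀ {m} → m ∈ˡ messages [a₂ᴼ,a₂ᴿ] → m ∉ˡ messages [r₂ᴼ,r₂ᴿ]
a₂∌r₂ (here refl)         (here ())
a₂∌r₂ (here refl)         (there (here ()))
a₂∌r₂ (there (here refl)) (here ())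
a₂∌r₂ (there (here refl)) (there (here ()))

verdict-a₂ : ∀ {m} → m ∈ˡ messages [a₂ᴼ,a₂ᴿ] → ∀ q → m ∈ˡ messages (verdict q) → verdict q ≡ [a₂ᴼ,a₂ᴿ]
verdict-a₂ a₂∈ abortᴼ   _   = refl
verdict-a₂ a₂∈ resolveᴼ r₂∈ = ⊥-elim (a₂∌r₂ a₂∈ r₂∈)
verdict-a₂ a₂∈ resolveᴿ r₂∈ = ⊥-elim (a₂∌r₂ a₂∈ r₂∈)

verdict-r₂ : ∀ {m} → m ∈ˡ messages [r₂ᴼ,r₂ᴿ] → ∀ q → m ∈ˡ messages (verdict q) → verdict q ≡ [r₂ᴼ,r₂ᴿ]
verdict-r₂ r₂∈ abortᴼ   a₂∈ = ⊥-elim (a₂∌r₂ a₂∈ r₂∈)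
verdict-r₂ r₂∈ resolveᴼ _   = refl
verdict-r₂ r₂∈ resolveᴿ _   = refl

replyKM-cases : ∀ v q → replyKM v q ≡ ι ⊎ replyKM v q ≡ verdict q
replyKM-cases v abortᴼ with aborted v ∨ recovered v
... | true  = inj₁ refl
... | false = inj₂ refl
replyKM-cases v resolveᴼ with aborted v ∨ recovered v
... | true  = inj₁ refl
... | false = inj₂ refl
replyKM-cases v resolveᴿ with aborted v ∨ recovered v
... | true  = inj₁ refl
... | false = inj₂ refl

replyKM-first : ∀ v q → outbox v ≡ [] → replyKM v q ≡ verdict q
replyKM-first v abortᴼ   eq rewrite eq = refl
replyKM-first v resolveᴼ eq rewrite eq = refl
replyKM-first v resolveᴿ eq rewrite eq = refl

replyKM-later : ∀ v q q′ → outbox v ≡ messages (verdict q′) → replyKM v q ≡ ι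
replyKM-later v abortᴼ   abortᴼ   eq rewrite eq = refl
replyKM-later v abortᴼ   resolveᴼ eq rewrite eq = refl
replyKM-later v abortᴼ   resolveᴿ eq rewrite eq = refl
replyKM-later v resolveᴼ abortᴼ   eq rewrite eq = refl
replyKM-later v resolveᴼ resolveᴼ eq rewrite eq = refl
replyKM-later v resolveᴼ resolveᴿ eq rewrite eq = refl
replyKM-later v resolveᴿ abortᴼ   eq rewrite eq = refl
replyKM-later v resolveᴿ resolveᴼ eq rewrite eq = refl
replyKM-later v resolveᴿ resolveᴿ eq rewrite eq = refl

backlog-did : ∀ reply mv v {q} → q ∈ˡ backlog reply (did mv ∷ v) → q ∈ˡ backlog reply v
backlog-did reply mv v q∈ with backlog reply v
... | q′ ∷ qs with mv | reply v q′
...   | ι         | ι         = there q∈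
...   | ι         | send _    = q∈
...   | ι         | [a₂ᴼ,a₂ᴿ] = q∈
...   | ι         | [r₂ᴼ,r₂ᴿ] = q∈
...   | send _    | _         = there q∈
...   | [a₂ᴼ,a₂ᴿ] | _         = there q∈
...   | [r₂ᴼ,r₂ᴿ] | _         = there q∈

backlog⊆requests : ∀ reply v {q} → q ∈ˡ backlog reply v → q ∈ˡ requests v
backlog⊆requests reply (did mv ∷ v) q∈ = ∈-++⁺ˡ (backlog⊆requests reply v (backlog-did reply mv v q∈))
backlog⊆requests reply (got m ∷ v)  q∈ with ∈-++⁻ (backlog reply v) q∈
... | inj₁ q∈v = ∈-++⁺ˡ (backlog⊆requests reply v q∈v)
... | inj₂ q∈m = ∈-++⁺ʳ (requests v) q∈m

ruleTTP⁻ : ∀ reply v {mv} → ruleTTP reply v ≡ just mv →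
           ∃[ q ] ∃[ qs ] backlog reply v ≡ q ∷ qs × mv ≡ reply v q
ruleTTP⁻ reply v eq with backlog reply v
ruleTTP⁻ reply v refl | q ∷ qs = q , qs , refl , refl

ruleTTP⁺ : ∀ reply v {q qs} → backlog reply v ≡ q ∷ qs → ruleTTP reply v ≡ just (reply v q)
ruleTTP⁺ reply v eq rewrite eq = refl

-- Before anything is sent every reply is a verdict, hence not `ι`, so an idle turn processes no
-- request. The head of the backlog is therefore the first request ever received.
backlog-silent : ∀ v → outbox v ≡ [] → backlog replyKM v ≡ requests v
backlog-silent []          _  = refl
backlog-silent (got m ∷ v) eq = cong (_++ request (got m)) (backlog-silent v eq)
backlog-silent (did ι ∷ v) eq = trans unprocessed (trans (backlog-silent v eq) (sym (++-identityʳ (requests v))))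
  where
  unprocessed : backlog replyKM (did ι ∷ v) ≡ backlog replyKM v
  unprocessed with backlog replyKM v
  ... | []         = refl
  ... | q ∷ _ with replyKM v q | replyKM-first v q eq
  unprocessed | abortᴼ   ∷ _ | _ | refl = refl
  unprocessed | resolveᴼ ∷ _ | _ | refl = refl
  unprocessed | resolveᴿ ∷ _ | _ | refl = refl

outbox-empty? : ∀ v → outbox v ≡ [] ⊎ ∃[ m ] m ∈ˡ outbox v
outbox-empty? v with outbox v
... | []    = inj₁ refl
... | m ∷ _ = inj₂ (m , here refl)

processKM : ℕ → Process
processKM s = Follow s (ruleTTP replyKM)

processKM⪯TTPᵍ : ∀ b s → processKM s ⪯ TTPᵍ b
processKM⪯TTPᵍ b s = Follow-refines TTPᵍ.idle λ v eq → allowed v (ruleTTP⁻ replyKM v eq)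
  where
  allowed : ∀ v {mv} → ∃[ q ] ∃[ qs ] backlog replyKM v ≡ q ∷ qs × mv ≡ replyKM v q → TTPᵍ b v mv
  allowed v (q , qs , eq , refl) with replyKM v q | replyKM-cases v q
  ... | _ | inj₁ refl = idle
  ... | _ | inj₂ refl =
    answer (backlog⊆requests replyKM v (subst (q ∈ˡ_) (sym eq) (here refl))) (verdict-answer q)

Answered : Pred View 0ℓ
Answered v = ∃[ m ] m ∈ˡ outbox v

answered-persistent : Persistent Answered
answered-persistent e v (m , m∈) = m , outbox-persistent e v m∈

-- The bound is 0: while silent with a request at hand, the third party always has a move
-- prescribed, so it may delay but never wait.
stage-answer : ∀ q v → head (requests v) ≡ just q → Stage (ruleTTP replyKM) 0 Answered v
stage-answer q v first with outbox-empty? v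
... | inj₂ some = reached some
... | inj₁ none with requests v in eq
...   | q′ ∷ qs = acts (ruleTTP⁺ replyKM v (trans (backlog-silent v none) eq)) (speaks (replyKM-first v q′ none))
  where
  speaks : ∀ {mv} → mv ≡ verdict q′ → Answered (did mv ∷ v)
  speaks refl = spoken q′
    where
    spoken : ∀ q → Answered (did (verdict q) ∷ v)
    spoken abortᴼ   = a₂ᴼ , here refl
    spoken resolveᴼ = r₂ᴼ , here refl
    spoken resolveᴿ = r₂ᴼ , here refl

-- The Kremer–Markowitch third party speaks at most once.
Settled : View → Set
Settled v = outbox v ≡ [] ⊎ ∃[ q ] head (requests v) ≡ just q × outbox v ≡ messages (verdict q)

module ThirdParty {ρ s} (plays : Plays Oᵍ Rᵍ (processKM s) ρ) where
  private
    follows = Turns.follows plays TTP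
    general : Plays Oᵍ Rᵍ (TTPᵍ true) ρ
    general = Plays-mono (λ { O → id ; R → id ; TTP {v} → proj₂ (processKM⪯TTPᵍ true s v) }) plays

  open Following {ρ} {TTP} {s} {ruleTTP replyKM} (Turns.turns plays TTP) follows
  open Exchange general
  open Temporal ρ

  -- A move prescribed in silence is the verdict on the head of the backlog, which `backlog-silent`
  -- identifies with the first request. Every reply after that is `ι` by `replyKM-later`.
  settled : ∀ n → Settled (view ρ TTP n)
  settled zero    = inj₁ refl
  settled (suc n) = by-cases (mover (ρ n) ≟ᵃ TTP) (settled n)
    where
    v = view ρ TTP n
    unchanged : outbox (view ρ TTP (suc n)) ≡ outbox v → Settled v → Settled (view ρ TTP (suc n))
    unchanged eq (inj₁ none) = inj₁ (trans eq none)
    unchanged eq (inj₂ (q , first , said)) =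
      inj₂ (q , persistent-view head-persistent (n≤1+n n) first , trans eq said)

    by-cases : Dec (mover (ρ n) ≡ TTP) → Settled v → Settled (view ρ TTP (suc n))
    by-cases (no neq) st = unchanged (outbox-other ρ n neq) st
    by-cases (yes eq) st = own (move (ρ n)) refl (follows n eq) st
      where
      said : ∀ {mv} → move (ρ n) ≡ mv → outbox (view ρ TTP (suc n)) ≡ messages mv ++ outbox v
      said refl = outbox-mover ρ n eq
      own : ∀ mv → move (ρ n) ≡ mv → processKM s v mv → Settled v → Settled (view ρ TTP (suc n))
      own .ι mv≡ (delay _) st = unchanged (said mv≡) st
      own .ι mv≡ (rest _)  st = unchanged (said mv≡) st
      own mv mv≡ (act r) st with q , qs , queue , mv≡reply ← ruleTTP⁻ replyKM v r | st
      ... | inj₂ (q′ , first , spoken) = unchanged (said (trans mv≡ (trans mv≡reply (replyKM-later v q q′ spoken)))) st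
      ... | inj₁ none = inj₂ (q ,
        persistent-view head-persistent (n≤1+n n) (cong head (trans (sym (backlog-silent v none)) queue)) ,
        trans (said (trans mv≡ (trans mv≡reply (replyKM-first v q none))))
              (trans (cong (messages (verdict q) ++_) none) (++-identityʳ _)))

  decides : ∀ n {q} → head (requests (view ρ TTP n)) ≡ just q →
            ∃[ k ] outbox (view ρ TTP k) ≡ messages (verdict q)
  decides n {q} first
    with k , first′ , m , m∈ ← reach head-persistent answered-persistent 0 (stage-answer q) n first
    with settled k
  ... | inj₁ none with () ← subst (m ∈ˡ_) none m∈
  ... | inj₂ (q′ , first″ , said) with refl ← trans (sym first′) first″ = k , said

  reasonableKM : Reasonable ρ
  reasonableKM = record
    { aborts   = λ n first → says-a₂ (decides n first)
    ; resolves = λ { n .resolveᴼ (inj₁ refl) first → says-r₂ (decides n first)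
                   ; n .resolveᴿ (inj₂ refl) first → says-r₂ (decides n first) }
    }
    where
    says-a₂ : ∃[ k ] outbox (view ρ TTP k) ≡ messages [a₂ᴼ,a₂ᴿ] → ∃[ k ] (a₂ᴼ SentAt k In ρ ⊎ a₂ᴿ SentAt k In ρ)
    says-a₂ (k , said) with j , _ , a₂∈ ← outbox⁻ ρ k (subst (a₂ᴼ ∈ˡ_) (sym said) (here refl)) = j , inj₁ a₂∈
    says-r₂ : ∃[ k ] outbox (view ρ TTP k) ≡ messages [r₂ᴼ,r₂ᴿ] → ∃[ k ] (r₂ᴼ SentAt k In ρ ⊎ r₂ᴿ SentAt k In ρ)
    says-r₂ (k , said) with j , _ , r₂∈ ← outbox⁻ ρ k (subst (r₂ᴼ ∈ˡ_) (sym said) (here refl)) = j , inj₁ r₂∈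

  spoken : ∀ n {m} → m ∈ˡ outbox (view ρ TTP n) →
           ∃[ q ] m ∈ˡ messages (verdict q) × outbox (view ρ TTP n) ≡ messages (verdict q)
  spoken n m∈ with settled n
  ... | inj₁ none           with () ← subst (_ ∈ˡ_) none m∈
  ... | inj₂ (q , _ , said) = q , subst (_ ∈ˡ_) said m∈ , said

  -- At the later of the two turns both messages are in the outbox, which by then is a single
  -- verdict.
  together : ∀ n n′ {m m′} → m ∈ˡ outbox (view ρ TTP n) → m′ ∈ˡ outbox (view ρ TTP n′) →
             ∃[ q ] m ∈ˡ messages (verdict q) × m′ ∈ˡ messages (verdict q)
  together n n′ m∈ m′∈ with q , m∈q , said ← spoken (n ⊔ n′) (persistent-view outbox-persistent (m≤m⊔n n n′) m∈) =
    q , m∈q , subst (_ ∈ˡ_) said (persistent-view outbox-persistent (m≤n⊔m n n′) m′∈)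

  Says : Msg → Set
  Says m = ∃[ n ] m ∈ˡ outbox (view ρ TTP n)

  -- `only` says that `m` gives the verdict away. Since a nonempty outbox is exactly one verdict,
  -- this fixes both what is said and all that can ever be said.
  agree : ∀ {m mv} → (∀ q → m ∈ˡ messages (verdict q) → verdict q ≡ mv) → Says m →
          (∀ {m′} → m′ ∈ˡ messages mv → Says m′) × (∀ {m′} → Says m′ → m′ ∈ˡ messages mv)
  agree {m} {mv} only (n , m∈) = both , neither
    where
    both : ∀ {m′} → m′ ∈ˡ messages mv → Says m′
    both m′∈ with q , m∈q , said ← spoken n m∈ =
      n , subst (_ ∈ˡ_) (sym (trans said (cong messages (only q m∈q)))) m′∈
    neither : ∀ {m′} → Says m′ → m′ ∈ˡ messages mv
    neither (n′ , m′∈) with q , m∈q , m′∈q ← together n n′ m∈ m′∈ =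
      subst (λ mv → _ ∈ˡ messages mv) (only q m∈q) m′∈q

  aborting : ∀ {m} → m ∈ˡ messages [a₂ᴼ,a₂ᴿ] → Says m → Says a₂ᴼ × Says a₂ᴿ × ¬ Says r₂ᴼ × ¬ Says r₂ᴿ
  aborting m∈ says with both , neither ← agree (verdict-a₂ m∈) says =
    both (here refl) , both (there (here refl)) ,
    (λ r → a₂∌r₂ (neither r) (here refl)) , (λ r → a₂∌r₂ (neither r) (there (here refl)))

  resolving : ∀ {m} → m ∈ˡ messages [r₂ᴼ,r₂ᴿ] → Says m → Says r₂ᴼ × Says r₂ᴿ × ¬ Says a₂ᴼ × ¬ Says a₂ᴿ
  resolving m∈ says with both , neither ← agree (verdict-r₂ m∈) says =
    both (here refl) , both (there (here refl)) ,
    (λ a → a₂∌r₂ (here refl) (neither a)) , (λ a → a₂∌r₂ (there (here refl)) (neither a))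

  heard⁻ : ∀ {p} (x : Var p) m {_ : T (setBy x (m ∷ []))} → Eventually x →
           ∃[ k ] m ∈ˡ outbox (view ρ (sender m) k)
  heard⁻ {p} x m {set} (n , t) with .m , here refl , m∈ ← received⁻ x (m ∷ []) {set} (view ρ p n) t = heard n m∈

  heard⁺ : ∀ m {x : Var (recipient m)} → T (onReceipt m x) → sender m ≡ TTP → Says m → Eventually x
  heard⁺ m {x} t eq (n , m∈) with k , m∈k ← delivers n m∈ (inj₁ eq) =
    k , value-in⁺ {x = x} (view ρ (recipient m) k) m∈k t

  requested : Eventually ABR ⊎ Eventually RES → ∃[ n ] ∃[ q ] q ∈ˡ requests (view ρ TTP n)
  requested (inj₁ (n , t)) with received⁻ ABR (a₁ᴼ ∷ []) (view ρ TTP n) t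
  ... | .a₁ᴼ , here refl , a₁∈ = n , abortᴼ , request⁺ (view ρ TTP n) a₁∈ (here refl)
  requested (inj₂ (n , t)) with received⁻ RES (r₁ᴼ ∷ r₁ᴿ ∷ []) (view ρ TTP n) t
  ... | .r₁ᴼ , here refl         , r₁∈ = n , resolveᴼ , request⁺ (view ρ TTP n) r₁∈ (here refl)
  ... | .r₁ᴿ , there (here refl) , r₁∈ = n , resolveᴿ , request⁺ (view ρ TTP n) r₁∈ (here refl)

  replied : ∀ q → (∀ {m} → m ∈ˡ messages (verdict q) → Says m) →
            Eventually AB-O ⊎ Eventually AB-R ⊎ Eventually Sig-O-TTP ⊎ Eventually Sig-R-TTP
  replied abortᴼ   says = inj₁ (heard⁺ a₂ᴼ {AB-O} tt refl (says (here refl)))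
  replied resolveᴼ says = inj₂ (inj₂ (inj₂ (heard⁺ r₂ᴼ {Sig-R-TTP} tt refl (says (here refl)))))
  replied resolveᴿ says = inj₂ (inj₂ (inj₂ (heard⁺ r₂ᴼ {Sig-R-TTP} tt refl (says (here refl)))))

  consistentKM : Consistent
  consistentKM = record
    { answered = λ asked →
        let n , q , q∈       = requested asked
            q′ , first , _   = head⁺ q∈
            k , said         = decides n first
        in replied q′ (λ m∈ → k , subst (_ ∈ˡ_) (sym said) m∈)
    -- The replacement for one agent's signature goes to the other agent: `r₂ᴿ` sets `Sig-O-TTP` and
    -- `r₂ᴼ` sets `Sig-R-TTP`. Hence the crossed order in the fields below.
    ; sig-O = λ e → let o , r , ¬o , ¬r = resolving (there (here refl)) (heard⁻ Sig-O-TTP r₂ᴿ e) in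
        heard⁺ r₂ᴼ {Sig-R-TTP} tt refl o , silent AB-O ¬o , silent AB-R ¬r
    ; sig-R = λ e → let o , r , ¬o , ¬r = resolving (here refl) (heard⁻ Sig-R-TTP r₂ᴼ e) in
        heard⁺ r₂ᴿ {Sig-O-TTP} tt refl r , silent AB-O ¬o , silent AB-R ¬r
    ; ab-O = λ e → let o , r , ¬o , ¬r = aborting (here refl) (heard⁻ AB-O a₂ᴼ e) in
        heard⁺ a₂ᴿ {AB-R} tt refl r , silent Sig-O-TTP ¬r , silent Sig-R-TTP ¬o
    ; ab-R = λ e → let o , r , ¬o , ¬r = aborting (there (here refl)) (heard⁻ AB-R a₂ᴿ e) in
        heard⁺ a₂ᴼ {AB-O} tt refl o , silent Sig-O-TTP ¬r , silent Sig-R-TTP ¬o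
    }
    where
    silent : ∀ {p} (x : Var p) {m} {_ : T (setBy x (m ∷ []))} → ¬ (∃[ k ] m ∈ˡ outbox (view ρ (sender m) k)) → Never x
    silent x {m} {set} ¬m n t = ¬m (heard⁻ x m {set} (n , t))

-- The four conditions for KM.

module _ (τ : Timing) where
  open Timing τ

  condition₁ : ∀ {b} → ⟦ mainO τ ∥ Rᵍ ∥ TTPᵍ b ⟧ ⊆ φ-TTP ⇒ φ-O
  condition₁ {b} (ρ , plays , reasonable , σ≡) ttp =
    φ-O⁺ σ≡ (n , value-out⁺ {x = M₁} (view ρ O n) m₁∈ tt)
      (fairForO reasonable outcomeO)
    where
    open Temporal ρ
    open Originator τ {ρ} {slack O} (Turns.turns plays O) (Turns.follows plays O)
    general : Plays Oᵍ Rᵍ (TTPᵍ b) ρ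
    general = Plays-mono (λ { O {v} → proj₂ (mainO⪯Oᵍ τ v) ; R → id ; TTP → id }) plays
    open Fairness general (φ-TTP⁻ σ≡ ttp)
    n = proj₁ sends-m₁
    m₁∈ = proj₂ sends-m₁

  condition₂ : ∀ {b} → ⟦ Oᵍ ∥ mainR τ ∥ TTPᵍ b ⟧ ⊆ φ-TTP ⇒ φ-R
  condition₂ {b} (ρ , plays , _ , σ≡) ttp = φ-R⁺ σ≡ (fairForR outcomeR)
    where
    open Temporal ρ
    open Recipient τ {ρ} {slack R} (Turns.turns plays R) (Turns.follows plays R)
    general : Plays Oᵍ Rᵍ (TTPᵍ b) ρ
    general = Plays-mono (λ { O → id ; R {v} → proj₂ (mainR⪯Rᵍ τ v) ; TTP → id }) plays
    open Fairness general (φ-TTP⁻ σ≡ ttp)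

  condition₃ : ⟦ Oᵍ ∥ Rᵍ ∥ processKM (slack TTP) ⟧ ⊆ φ-TTP
  condition₃ (ρ , plays , _ , σ≡) = Temporal.φ-TTP⁺ ρ σ≡ (ThirdParty.consistentKM plays)

  KM∈P-AGS : ∀ b → P-KM τ ∈ P-AGS b
  KM∈P-AGS b = record
    { refines-O   = mainO⪯Oᵍ τ
    ; refines-R   = mainR⪯Rᵍ τ
    ; refines-TTP = processKM⪯TTPᵍ b (slack TTP)
    ; reasonable  = λ ρ plays → ThirdParty.reasonableKM plays
    ; condition₁  = λ t (_ , ttp) → condition₁ t ttp
    ; condition₂  = λ t (_ , ttp) → condition₂ t ttp
    ; condition₃  = λ t _ → condition₃ t
    ; condition₄  = λ t →
        let ttp = condition₃ (widen (λ { O {v} → o v ; R {v} → r v ; TTP → id }) t)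
        in condition₁ {b} (widen (λ { O → id ; R {v} → r v ; TTP {v} → k v }) t) ttp
         , condition₂ {b} (widen (λ { O {v} → o v ; R → id ; TTP {v} → k v }) t) ttp
         , ttp
    }
    where
    o = λ v {mv} → proj₂ (mainO⪯Oᵍ τ v) {mv}
    r = λ v {mv} → proj₂ (mainR⪯Rᵍ τ v) {mv}
    k = λ v {mv} → proj₂ (processKM⪯TTPᵍ b (slack TTP) v) {mv}
    -- Reasonableness and the valuation depend on the run alone, so only `Plays` has to be
    -- transported.
    widen : ∀ {o r t o′ r′ t′} → (∀ p {v} → team o r t p v ⊆ team o′ r′ t′ p v) →
            ⟦ o ∥ r ∥ t ⟧ ⊆ ⟦ o′ ∥ r′ ∥ t′ ⟧
    widen sub (ρ , plays , others) = ρ , Plays-mono sub plays , others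

-- The run in which `m₁` is lost and the originator aborts.

idleTurn : Agent → Turn
idleTurn p = record { mover = p ; move = ι ; arrivals = [] }

roundRobin : ℕ → Agent
roundRobin 0                   = O
roundRobin 1                   = R
roundRobin 2                   = TTP
roundRobin (suc (suc (suc n))) = roundRobin n

roundRobin-fair : ∀ p n → ∃[ k ] n ≤ k × roundRobin k ≡ p
roundRobin-fair O   zero = 0 , z≤n , refl
roundRobin-fair R   zero = 1 , z≤n , refl
roundRobin-fair TTP zero = 2 , z≤n , refl
roundRobin-fair p (suc n) with k , n≤k , eq ← roundRobin-fair p n =
  suc (suc (suc k)) , s≤s (≤-trans n≤k (m≤n+m k 2)) , eq

-- `t` is the absolute turn of the abort request, fixed through the recursion to label the arrivals,
-- while `wait` counts down. Both messages are delivered in the turn that sends them; afterwards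
-- everyone idles in rotation.
abortAfter : (t wait : ℕ) → Run
abortAfter t (suc w) zero    = idleTurn O
abortAfter t (suc w) (suc n) = abortAfter t w n
abortAfter t zero    0       = record { mover = O ; move = send a₁ᴼ ; arrivals = [ t , a₁ᴼ ] }
abortAfter t zero    1       = record { mover = TTP ; move = send a₂ᴼ ; arrivals = [ suc t , a₂ᴼ ] }
abortAfter t zero    (suc (suc n)) = idleTurn (roundRobin n)

-- The message m₁ is lost, so the recipient never takes part.
abortRun : ℕ → Run
abortRun w zero    = record { mover = O ; move = send m₁ ; arrivals = [] }
abortRun w (suc n) = abortAfter (suc w) w n

abortAfter-late : ∀ t w j → abortAfter t w (j + w) ≡ abortAfter t zero j
abortAfter-late t zero    j = cong (abortAfter t zero) (+-identityʳ j)
abortAfter-late t (suc w) j = trans (cong (abortAfter t (suc w)) (+-suc j w)) (abortAfter-late t w j)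

abortAfter-early : ∀ t w n → n < w → abortAfter t w n ≡ idleTurn O
abortAfter-early t (suc w) zero    _         = refl
abortAfter-early t (suc w) (suc n) (s≤s n<w) = abortAfter-early t w n n<w

-- The indices have the shape in which `turn-early` and `turn-late` rewrite a turn to closed form.
data Phase (w : ℕ) : ℕ → Set where
  start  : Phase w 0
  early  : ∀ {i} → i < w → Phase w (suc i)
  late   : ∀ j → Phase w (suc (j + w))

phase : ∀ w n → Phase w n
phase w zero    = start
phase w (suc i) with i <? w
... | yes i<w = early i<w
... | no  i≮w = subst (Phase w ∘ suc) (m∸n+n≡m (≮⇒≥ i≮w)) (late (i ∸ w))

waiting : ℕ → View
waiting i = replicate i (did ι) ++ did (send m₁) ∷ []

waited-waiting : ∀ i → waited (waiting i) ≡ i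
waited-waiting zero    = refl
waited-waiting (suc i) = cong suc (waited-waiting i)

outbox-idles : ∀ i v → outbox (replicate i (did ι) ++ v) ≡ outbox v
outbox-idles zero    v = refl
outbox-idles (suc i) v = outbox-idles i v

inbox-idles : ∀ i v → inbox (replicate i (did ι) ++ v) ≡ inbox v
inbox-idles zero    v = refl
inbox-idles (suc i) v = inbox-idles i v

backlog-idles : ∀ reply i v → backlog reply v ≡ [] → backlog reply (replicate i (did ι) ++ v) ≡ []
backlog-idles reply zero    v eq = eq
backlog-idles reply (suc i) v eq rewrite backlog-idles reply i v eq = refl

module Lost (w : ℕ) where
  ρ : Run
  ρ = abortRun w

  turn-early : ∀ {i} → i < w → ρ (suc i) ≡ idleTurn O
  turn-early {i} = abortAfter-early (suc w) w i

  turn-late : ∀ j → ρ (suc (j + w)) ≡ abortAfter (suc w) zero j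
  turn-late = abortAfter-late (suc w) w

  viewO-early : ∀ i → i ≤ w → view ρ O (suc i) ≡ waiting i
  viewO-early zero    _   = refl
  viewO-early (suc i) i<w rewrite turn-early i<w = cong (did ι ∷_) (viewO-early i (<⇒≤ i<w))

  viewTTP-early : ∀ i → i ≤ w → view ρ TTP (suc i) ≡ []
  viewTTP-early zero    _   = refl
  viewTTP-early (suc i) i<w rewrite turn-early i<w = viewTTP-early i (<⇒≤ i<w)

  viewR-early : ∀ i → i ≤ w → view ρ R (suc i) ≡ []
  viewR-early zero    _   = refl
  viewR-early (suc i) i<w rewrite turn-early i<w = viewR-early i (<⇒≤ i<w)

  settledView : Agent → View
  settledView O   = got a₂ᴼ ∷ did (send a₁ᴼ) ∷ waiting w
  settledView R   = []
  settledView TTP = did (send a₂ᴼ) ∷ got a₁ᴼ ∷ []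

  view-aborted : view ρ TTP (suc (1 + w)) ≡ got a₁ᴼ ∷ []
  view-aborted rewrite turn-late 0 = cong (got a₁ᴼ ∷_) (viewTTP-early w ≤-refl)

  view-settled : ∀ p → view ρ p (suc (2 + w)) ≡ settledView p
  view-settled O   rewrite turn-late 1 | turn-late 0 = cong (λ v → got a₂ᴼ ∷ did (send a₁ᴼ) ∷ v) (viewO-early w ≤-refl)
  view-settled R   rewrite turn-late 1 | turn-late 0 = viewR-early w ≤-refl
  view-settled TTP rewrite turn-late 1 = cong (did (send a₂ᴼ) ∷_) view-aborted

  view-late : ∀ p j → ∃[ i ] view ρ p (suc (2 + j + w)) ≡ replicate i (did ι) ++ settledView p
  view-late p zero = 0 , view-settled p
  view-late p (suc j) with i , eq ← view-late p j rewrite turn-late (2 + j) with does (roundRobin j ≟ᵃ p)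
  ... | true  = suc i , cong (did ι ∷_) eq
  ... | false = i , eq

  arrivals-only : ∀ n {k m} → (k , m) ∈ˡ arrivals (ρ n) → m ≡ a₁ᴼ ⊎ m ≡ a₂ᴼ
  arrivals-only n km∈ with phase w n
  arrivals-only .0 () | start
  ... | early i<w rewrite turn-early i<w with () ← km∈
  ... | late 0 rewrite turn-late 0 with here refl ← km∈ = inj₁ refl
  ... | late 1 rewrite turn-late 1 with here refl ← km∈ = inj₂ refl
  ... | late (suc (suc j)) rewrite turn-late (2 + j) with () ← km∈

  a₁-sent : a₁ᴼ SentAt suc w In ρ
  a₁-sent = subst (λ t → a₁ᴼ ∈ˡ messages (move t)) (sym (turn-late 0)) (here refl)

  a₂-sent : a₂ᴼ SentAt suc (suc w) In ρ
  a₂-sent = subst (λ t → a₂ᴼ ∈ˡ messages (move t)) (sym (turn-late 1)) (here refl)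

  genuine : ∀ n {k m} → (k , m) ∈ˡ arrivals (ρ n) → k ≤ n × m SentAt k In ρ
  genuine n km∈ with phase w n
  genuine .0 () | start
  ... | early i<w rewrite turn-early i<w with () ← km∈
  ... | late 0 rewrite turn-late 0 with here refl ← km∈ = ≤-refl , a₁-sent
  ... | late 1 rewrite turn-late 1 with here refl ← km∈ = ≤-refl , a₂-sent
  ... | late (suc (suc j)) rewrite turn-late (2 + j) with () ← km∈

  resilient : ∀ k {m} → m SentAt k In ρ → Resilient m → ∃[ n ] (k , m) ∈ˡ arrivals (ρ n)
  resilient k m∈ res with phase w k
  -- `m₁` runs between the agents, where the channel is allowed to lose it.
  ... | start with here refl ← m∈ | res
  ...   | inj₁ ()
  ...   | inj₂ ()
  resilient k m∈ res | early i<w rewrite turn-early i<w with () ← m∈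
  resilient k m∈ res | late 0 rewrite turn-late 0 with here refl ← m∈ =
    suc w , subst (λ t → (suc w , a₁ᴼ) ∈ˡ arrivals t) (sym (turn-late 0)) (here refl)
  resilient k m∈ res | late 1 rewrite turn-late 1 with here refl ← m∈ =
    suc (suc w) , subst (λ t → (suc (suc w) , a₂ᴼ) ∈ˡ arrivals t) (sym (turn-late 1)) (here refl)
  resilient k m∈ res | late (suc (suc j)) rewrite turn-late (2 + j) with () ← m∈

  log : ℕ → List (ℕ × Msg)
  log n = concatMap arrivals (applyDownFrom ρ n)

  log-early : ∀ i → i ≤ w → log (suc i) ≡ []
  log-early zero    _   = refl
  log-early (suc i) i<w rewrite turn-early i<w = log-early i (<⇒≤ i<w)

  log-aborted : log (suc (1 + w)) ≡ (suc w , a₁ᴼ) ∷ []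
  log-aborted rewrite turn-late 0 = cong ((suc w , a₁ᴼ) ∷_) (log-early w ≤-refl)

  log-late : ∀ j → log (suc (2 + j + w)) ≡ (suc (suc w) , a₂ᴼ) ∷ (suc w , a₁ᴼ) ∷ []
  log-late zero    rewrite turn-late 1 = cong ((suc (suc w) , a₂ᴼ) ∷_) log-aborted
  log-late (suc j) rewrite turn-late (2 + j) = log-late j

  once : ∀ n → Unique (log n)
  once n with phase w n
  ... | start                      = []
  ... | early {i} i<w              = subst Unique (sym (log-early i (<⇒≤ i<w))) []
  ... | late 0                     = subst Unique (sym (log-early w ≤-refl)) []
  ... | late 1                     = subst Unique (sym log-aborted) ([] ∷ [])
  ... | late (suc (suc j))         = subst Unique (sym (log-late j)) (((λ ()) ∷ []) ∷ [] ∷ [])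

  channels : Channels ρ
  channels = record { genuine = genuine ; once = once ; resilient = resilient }

  -- Looks only at the length of the past: `Fair` quantifies over every run that the scheduler
  -- admits, so its turns must rotate whatever the moves are.
  scheduler : Scheduler
  scheduler past = mover (ρ (length past))

  scheduled : scheduler Schedules ρ
  scheduled n = cong (mover ∘ ρ) (sym (length-applyDownFrom ρ n))

  fair : Fair scheduler
  fair ρ′ sch p n with j , n≤j , eq ← roundRobin-fair p n = k , ≤-trans n≤j (≤-trans (m≤m+n j w) (m≤n+m (j + w) 3)) ,
    trans (sch k) (trans (cong (mover ∘ ρ) (length-applyDownFrom ρ′ k)) (trans (cong mover (turn-late (2 + j))) eq))
    where k = suc (2 + j + w)

-- Failure of ASW and GJM.

-- `prompt` isolates the defect common to both protocols: a first abort request is answered to the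
-- originator alone. For each of the two reply tables it holds by evaluation.
module LostPlays (τ : Timing) (reply : Reply) (prompt : reply (got a₁ᴼ ∷ []) abortᴼ ≡ send a₂ᴼ) where
  open Timing τ
  -- After exactly `late₂` idle turns `ruleO` begins to prescribe `a₁ᴼ`, and the run obeys at once.
  open Lost late₂
  open Temporal ρ

  restO-early : ∀ {i} → i < late₂ → ruleO τ (waiting i) ≡ nothing
  restO-early {i} i<w
    rewrite outbox-idles i (did (send m₁) ∷ []) | inbox-idles i (did (send m₁) ∷ [])
          | waited-waiting i with late₂ ≤ᵇ i in eq
  ... | false = refl
  ... | true  = contradiction (≤ᵇ⇒≤ late₂ i (subst T (sym eq) tt)) (<⇒≱ i<w)

  abortsO : ruleO τ (waiting late₂) ≡ just (send a₁ᴼ)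
  abortsO
    rewrite outbox-idles late₂ (did (send m₁) ∷ []) | inbox-idles late₂ (did (send m₁) ∷ [])
          | waited-waiting late₂ with late₂ ≤ᵇ late₂ in eq
  ... | true  = refl
  ... | false = ⊥-elim (subst T eq (≤⇒≤ᵇ {late₂} ≤-refl))

  rule : Agent → Rule
  rule O   = ruleO τ
  rule R   = ruleR τ
  rule TTP = ruleTTP reply

  -- The originator has sent `a₁ᴼ`, the recipient has never received `m₁`, and the backlog of the
  -- third party is empty again; idle turns change none of this.
  rest-late : ∀ p i → rule p (replicate i (did ι) ++ settledView p) ≡ nothing
  rest-late O i
    rewrite outbox-idles i (settledView O) | outbox-idles late₂ (did (send m₁) ∷ []) = refl
  rest-late R i rewrite inbox-idles i [] = refl
  rest-late TTP i rewrite backlog-idles reply i (settledView TTP) refl = refl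

  Team : Agent → Process
  Team = team (mainO τ) (mainR τ) (Follow (slack TTP) (ruleTTP reply))

  rests : ∀ p v → rule p v ≡ nothing → Team p v ι
  rests O   v = rest
  rests R   v = rest
  rests TTP v = rest

  moves : ∀ n → let p = mover (ρ n) in Team p (view ρ p n) (move (ρ n))
  moves n with phase late₂ n
  ... | start = act refl
  ... | early {i} i<w rewrite turn-early i<w | viewO-early i (<⇒≤ i<w) = rest (restO-early i<w)
  ... | late 0 rewrite turn-late 0 | viewO-early late₂ ≤-refl = act abortsO
  ... | late 1 rewrite turn-late 1 | view-aborted = act (cong just prompt)
  ... | late (suc (suc j)) rewrite turn-late (2 + j) with p ← roundRobin j with i , eq ← view-late p j =
    rests p _ (trans (cong (rule p) eq) (rest-late p i))

  plays : Plays (mainO τ) (mainR τ) (Follow (slack TTP) (ruleTTP reply)) ρ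
  plays = record { scheduler = scheduler ; fair = fair ; scheduled = scheduled ; moves = moves ; channels = channels }

  reasonable : Reasonable ρ
  reasonable = record
    -- Reasonableness asks for a token to at least one agent, so it does not detect that the
    -- recipient gets none.
    { aborts   = λ _ _ → suc (1 + late₂) , inj₁ a₂-sent
    ; resolves = λ n q res first → ⊥-elim (unasked n q res first)
    }
    where
    unasked : ∀ n q → q ≡ resolveᴼ ⊎ q ≡ resolveᴿ → head (requests (view ρ TTP n)) ≢ just q
    unasked n q res first with requests (view ρ TTP n) in eq
    ... | _ ∷ _ with refl ← first
      with m , m∈ , q∈ ← request⁻ (view ρ TTP n) (subst (q ∈ˡ_) (sym eq) (here refl))
      with k , (j , jm∈) , _ ← inbox⁻ ρ n m∈
      with arrivals-only k jm∈ | res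
    ... | inj₁ refl | inj₁ refl with here () ← q∈
    ... | inj₁ refl | inj₂ refl with here () ← q∈
    ... | inj₂ refl | _         with () ← q∈

  σ : Trace
  σ n p x = value (view ρ p n) x

  ¬φ-TTP : ¬ φ-TTP σ
  ¬φ-TTP ttp with (n , t) , _ ← Consistent.ab-O (φ-TTP⁻ (λ _ _ _ → refl) ttp)
      (suc (2 + late₂) , subst (λ v → T (value v AB-O)) (sym (view-settled O))
        (value-in⁺ {x = AB-O} (settledView O) (here refl) tt))
    with .a₂ᴿ , here refl , a₂∈ ← received⁻ AB-R (a₂ᴿ ∷ []) (view ρ R n) t
    with k , (j , ja₂∈) , _ ← inbox⁻ ρ n a₂∈
    with arrivals-only k ja₂∈
  ... | inj₁ ()
  ... | inj₂ ()

  ∉P-AGS : ∀ b → corresponding reply τ ∉ P-AGS b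
  ∉P-AGS b P∈ = ¬φ-TTP (proj₂ (proj₂ (P-AGS.condition₄ P∈ {σ} (ρ , plays , reasonable , λ _ _ _ → refl))))

theorem7 : (withReq : Bool) (τ : Timing) →
    (P-KM τ ∈ P-AGS withReq) × (P-ASW τ ∉ P-AGS withReq) × (P-GJM τ ∉ P-AGS withReq)
theorem7 withReq τ =
  KM∈P-AGS τ withReq , LostPlays.∉P-AGS τ replyASW refl withReq , LostPlays.∉P-AGS τ replyGJM refl withReq
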